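{- For every positive integer $n$, we have $\mu(Q_n) > \frac{14}{75}\cdot 2^n$.
   Context: For a positive integer $n$, write $[n]=\{1,\dots,n\}$. The $n$-dimensional hypercube $Q_n$ is the graph on the vertex set $2^{[n]}$ (all subsets of $[n]$), where $A,B\in 2^{[n]}$ are adjacent if and only if $|A\Delta B|=1$, with $A\Delta B=(A\setminus B)\cup(B\setminus A)$. Let $G$ be a simple graph and $M\subseteq V(G)$. Two vertices $u,v\in V(G)$ are $M$-visible if there exists a shortest $u,v$-path in $G$ that contains no vertices from $M\setminus\{u,v\}$. The set $M$ is a mutual-visibility set if any two vertices $u,v\in M$ are $M$-visible. The mutual-visibility number $\mu(G)$ is the largest size of a mutual-visibility set in $G$. -}

module Defs where

open import Data.Bool.Properties using () renaming (_≟_ to _≟ᵇ_)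
open import Data.Fin using (Fin; zero; suc)
open import Data.Fin.Properties using (injective⇒≤)
open import Data.Fin.Subset using (Subset; inside; outside; _∪_; _─_; ∣_∣)
open import Data.Fin.Subset.Properties using (∪-comm)
open import Data.List using (List; []; _∷_; [_]; length; lookup; head; last; map; _++_; filter; cartesianProductWith)
open import Data.List.Extrema.Nat using (argmax; argmax-all; f[xs]≤f[argmax])
open import Data.List.Membership.Propositional using (_∈_; lose; find)
open import Data.List.Membership.Propositional.Properties
  using (∈-map⁺; ∈-++⁺ˡ; ∈-++⁺ʳ; ∈-filter⁺; ∈-lookup; ∈-cartesianProductWith⁺)
open import Data.List.Relation.Unary.All as All using (All; []; _∷_; all?)
open import Data.List.Relation.Unary.All.Properties using (all-filter)
open import Data.List.Relation.Unary.AllPairs using ([]; _∷_)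
open import Data.List.Relation.Unary.Any using (here; there; any?; index)
open import Data.List.Relation.Unary.Any.Properties using (lookup-index)
open import Data.List.Relation.Unary.Linked using (Linked; linked?)
open import Data.List.Relation.Unary.Unique.Propositional using (Unique)
open import Data.List.Relation.Unary.Unique.DecPropositional using (unique?)
open import Data.Maybe using (just)
open import Data.Maybe.Properties using () renaming (≡-dec to ≡-dec-Maybe)
open import Data.Nat using (ℕ; zero; suc; _≤_; s≤s; _≤?_)
open import Data.Nat.Properties using () renaming (_≟_ to _≟ⁿ_)
open import Data.Product using (∃; ∃-syntax; _×_; _,_; proj₁; proj₂)
open import Data.Vec using ([]; _∷_)
open import Data.Vec.Properties using () renaming (≡-dec to ≡-dec-Vec)
open import Relation.Binary.Definitions using (DecidableEquality; Symmetric; Irreflexive)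
  renaming (Decidable to Decidable₂)
open import Relation.Binary.PropositionalEquality
  using (_≡_; _≢_; refl; sym; trans; cong; subst)
open import Relation.Nullary using (¬_; Dec; yes; no; ¬?; _×-dec_; contradiction)
open import Relation.Nullary.Decidable using (map′)
open import Relation.Unary using (Decidable)

record FiniteSimpleGraph : Set₁ where
  infix 4 _~_ _≟_ _~?_
  field
    V        : Set
    _~_      : V → V → Set
    ~-sym    : Symmetric _~_
    ~-irrefl : Irreflexive _≡_ _~_
    _≟_      : DecidableEquality V
    _~?_     : Decidable₂ _~_
    vertices : List V
    complete : ∀ v → v ∈ vertices

-- A set of vertices is a duplicate-free list, so that its cardinality is its
-- length; a path is the list of the vertices it visits, in order.
module _ (G : FiniteSimpleGraph) where
  open FiniteSimpleGraph G

  record IsPath (u v : V) (p : List V) : Set where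
    constructor mkIsPath
    field
      starts   : head p ≡ just u
      ends     : last p ≡ just v
      adjacent : Linked _~_ p
      distinct : Unique p

  -- Comparing numbers of vertices is the same as comparing numbers of edges,
  -- since a path with k edges has k + 1 vertices.
  IsShortestPath : V → V → List V → Set
  IsShortestPath u v p = IsPath u v p × (∀ q → IsPath u v q → length p ≤ length q)

  Visible : List V → V → V → Set
  Visible M u v =
    ∃[ p ] IsShortestPath u v p × All (λ w → ¬ (w ∈ M × w ≢ u × w ≢ v)) p

  record IsMutualVisibilitySet (M : List V) : Set where
    constructor mkIsMutualVisibilitySet
    field
      isSet   : Unique M
      visible : ∀ u v → u ∈ M → v ∈ M → Visible M u v

  record IsMutualVisibilityNumber (m : ℕ) : Set where
    constructor mkIsMutualVisibilityNumber
    field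
      attained : ∃[ M ] IsMutualVisibilitySet M × length M ≡ m
      maximal  : ∀ M → IsMutualVisibilitySet M → length M ≤ m

  -- The maximum exists because all the notions above are decidable and
  -- duplicate-free lists of vertices have bounded length.
  private
    lookup-injective : ∀ {xs : List V} → Unique xs → ∀ {i j : Fin (length xs)} →
                       lookup xs i ≡ lookup xs j → i ≡ j
    lookup-injective (_ ∷ _) {zero} {zero} _ = refl
    lookup-injective {x ∷ xs} (x∉ ∷ _) {zero} {suc j} eq =
      contradiction eq (All.lookup x∉ (∈-lookup j))
    lookup-injective {x ∷ xs} (x∉ ∷ _) {suc i} {zero} eq =
      contradiction (sym eq) (All.lookup x∉ (∈-lookup i))
    lookup-injective (_ ∷ u) {suc i} {suc j} eq = cong suc (lookup-injective u eq)

    index-injective : ∀ {x y} → index (complete x) ≡ index (complete y) → x ≡ y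
    index-injective {x} {y} eq =
      trans (lookup-index (complete x))
        (trans (cong (lookup vertices) eq) (sym (lookup-index (complete y))))

    unique⇒length≤ : ∀ {xs} → Unique xs → length xs ≤ length vertices
    unique⇒length≤ {xs} u =
      injective⇒≤ {f = λ i → index (complete (lookup xs i))}
        (λ eq → lookup-injective u (index-injective eq))

    listsUpTo : ℕ → List (List V)
    listsUpTo zero    = [ [] ]
    listsUpTo (suc k) = [] ∷ cartesianProductWith _∷_ vertices (listsUpTo k)

    ∈-listsUpTo : ∀ {k} xs → length xs ≤ k → xs ∈ listsUpTo k
    ∈-listsUpTo {zero}  []       _       = here refl
    ∈-listsUpTo {suc k} []       _       = here refl
    ∈-listsUpTo {suc k} (x ∷ xs) (s≤s l) =
      there (∈-cartesianProductWith⁺ _∷_ (complete x) (∈-listsUpTo xs l))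

    candidates : List (List V)
    candidates = listsUpTo (length vertices)

    ∈-candidates : ∀ {xs} → Unique xs → xs ∈ candidates
    ∈-candidates u = ∈-listsUpTo _ (unique⇒length≤ u)

    isPath? : ∀ u v → Decidable (IsPath u v)
    isPath? u v p =
      map′ (λ (s , e , a , d) → mkIsPath s e a d)
           (λ (mkIsPath s e a d) → s , e , a , d)
           (≡-dec-Maybe _≟_ (head p) (just u) ×-dec ≡-dec-Maybe _≟_ (last p) (just v)
             ×-dec linked? _~?_ p ×-dec unique? _≟_ p)

    isShortestPath? : ∀ u v → Decidable (IsShortestPath u v)
    isShortestPath? u v p = isPath? u v p ×-dec
      map′ (λ all q path → All.lookup all (∈-filter⁺ (isPath? u v)
                             (∈-candidates (IsPath.distinct path)) path))
           (λ f → All.map (λ {q} → f q) (all-filter (isPath? u v) candidates))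
           (all? (λ q → length p ≤? length q) (filter (isPath? u v) candidates))

    open import Data.List.Membership.DecPropositional _≟_ using (_∈?_)

    visible? : ∀ M u v → Dec (Visible M u v)
    visible? M u v =
      map′ (λ any → let p , _ , h = find any in p , h)
           (λ (p , h) → lose (∈-candidates (IsPath.distinct (proj₁ (proj₁ h)))) h)
           (any? (λ p → isShortestPath? u v p ×-dec
                   all? (λ w → ¬? (w ∈? M ×-dec ¬? (w ≟ u) ×-dec ¬? (w ≟ v))) p)
                 candidates)

    isMutualVisibilitySet? : Decidable IsMutualVisibilitySet
    isMutualVisibilitySet? M =
      map′ (λ (s , all) → mkIsMutualVisibilitySet s
              (λ u v u∈ v∈ → All.lookup (All.lookup all u∈) v∈))
           (λ (mkIsMutualVisibilitySet s h) → s ,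
              All.tabulate (λ u∈ → All.tabulate (λ v∈ → h _ _ u∈ v∈)))
           (unique? _≟_ M ×-dec all? (λ u → all? (visible? M u) M) M)

  abstract
    mutualVisibilityNumber : ∃ IsMutualVisibilityNumber
    mutualVisibilityNumber = length best , mkIsMutualVisibilityNumber
      (best , argmax-all length {P = IsMutualVisibilitySet}
                (mkIsMutualVisibilitySet [] (λ _ _ ()))
                (all-filter isMutualVisibilitySet? candidates) , refl)
      (λ M h → All.lookup (f[xs]≤f[argmax] {f = length} [] sets)
                 (∈-filter⁺ isMutualVisibilitySet?
                   (∈-candidates (IsMutualVisibilitySet.isSet h)) h))
      where
      sets : List (List V)
      sets = filter isMutualVisibilitySet? candidates

      best : List V
      best = argmax length [] sets

  μ : ℕ
  μ = proj₁ mutualVisibilityNumber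

  μ-isMutualVisibilityNumber : IsMutualVisibilityNumber μ
  μ-isMutualVisibilityNumber = proj₂ mutualVisibilityNumber

infixl 5 _△_
_△_ : ∀ {n} → Subset n → Subset n → Subset n
A △ B = (A ─ B) ∪ (B ─ A)

private
  ∣A△A∣≡0 : ∀ {n} (A : Subset n) → ∣ A △ A ∣ ≡ 0
  ∣A△A∣≡0 []            = refl
  ∣A△A∣≡0 (inside  ∷ A) = ∣A△A∣≡0 A
  ∣A△A∣≡0 (outside ∷ A) = ∣A△A∣≡0 A

subsets : ∀ n → List (Subset n)
subsets zero    = [ [] ]
subsets (suc n) = map (outside ∷_) (subsets n) ++ map (inside ∷_) (subsets n)

∈-subsets : ∀ {n} (A : Subset n) → A ∈ subsets n
∈-subsets []                    = here refl
∈-subsets {suc n} (outside ∷ A) = ∈-++⁺ˡ (∈-map⁺ (outside ∷_) (∈-subsets A))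
∈-subsets {suc n} (inside  ∷ A) =
  ∈-++⁺ʳ (map (outside ∷_) (subsets n)) (∈-map⁺ (inside ∷_) (∈-subsets A))

Q : ℕ → FiniteSimpleGraph
Q n = record
  { V        = Subset n
  ; _~_      = λ A B → ∣ A △ B ∣ ≡ 1
  ; ~-sym    = λ {A} {B} → subst (λ C → ∣ C ∣ ≡ 1) (∪-comm (A ─ B) (B ─ A))
  ; ~-irrefl = λ { {A} refl eq → contradiction (trans (sym (∣A△A∣≡0 A)) eq) λ () }
  ; _≟_      = ≡-dec-Vec _≟ᵇ_
  ; _~?_     = λ A B → ∣ A △ B ∣ ≟ⁿ 1
  ; vertices = subsets n
  ; complete = ∈-subsets
  }

{-# OPTIONS --safe #-}
module Submission where

-- Assign to every element of [n] a vector of 𝔽₃ʳ and call an r-set good if its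
-- vectors form a basis.  On average over the assignments a fraction
-- (1 - 3⁻¹)⋯(1 - 3⁻ʳ) > 14/25 of all r-sets is good, so for each r some
-- assignment does at least as well.  Fix one for each r, and let M consist of
-- the good sets whose size lies in a fixed residue class modulo 3; for one of the
-- three classes ∣M∣ ≥ (14/75) 2ⁿ, with equality excluded by divisibility by 3.
-- To join A, B ∈ M with ∣A∣ ≤ ∣B∣, alternately add an element of B and remove one
-- outside B, using only the two empty layers above A, until the set C reached
-- lies in B.  Then climb to B: a layer r of M is crossed from a set C ⊆ B of size
-- r - 2 by adding two of the at least five elements of B ∖ C so that the result is
-- not good.  This is possible because five vectors, taken modulo the span of C,
-- would be pairwise independent in a plane over 𝔽₃, which has only four directions.

open import Defs

module Hypercube where
  open import Data.Bool using (true; false)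
  open import Data.Fin as Fin using (Fin; zero; suc)
  open import Data.Fin.Properties as Fin using (injective⇒≤) renaming (all? to allFin?)
  open import Data.Fin.Subset using (Subset; inside; outside; _∪_; _∩_; _─_; ∣_∣; _⊆_; _∈_)
  open import Data.Fin.Subset.Properties
    using (_⊆?_; anySubset?; ∣p∣≤n; drop-there; drop-∷-⊆; ⊆-refl; ⊆-trans; s⊆s; out⊆; p⊆q⇒∣p∣≤∣q∣;
           p⊆p∪q; q⊆p∪q; x∈p∪q⁻; x∈p∩q⁺)
  import Data.Integer as ℤ
  import Data.Integer.Properties as ℤ
  open import Data.List as List
    using (List; []; _∷_; [_]; length; head; last; map; _++_; cartesianProductWith; allFin; filter; downFrom)
  open import Data.List.Properties using (length-++; length-map)
  import Data.List.Membership.DecPropositional as DecPropositional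
  open import Data.List.Membership.Propositional using (_∉_) renaming (_∈_ to _∈ˡ_)
  open import Data.List.Membership.Propositional.Properties
  open import Data.List.Relation.Unary.All as All using (All; []; _∷_)
  open import Data.List.Relation.Unary.AllPairs using ([]; _∷_)
  open import Data.List.Relation.Unary.Any using (here; there; index)
  open import Data.List.Relation.Unary.Any.Properties using (lookup-index)
  open import Data.List.Relation.Unary.Linked using (Linked; [-]; _∷_)
  open import Data.List.Relation.Unary.Unique.Propositional using (Unique)
  import Data.List.Relation.Unary.Unique.Propositional.Properties as Unique
  open import Data.Maybe using (just)
  open import Data.Nat
  open import Data.Nat.Divisibility using (_∣_; divides; _∣?_)
  open import Data.Nat.Primality using (Prime; prime?; euclidsLemma)
  open import Data.Nat.Properties
  open import Data.Nat.Solver using (module +-*-Solver)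
  open import Data.Product using (∃-syntax; _×_; _,_; proj₁; proj₂)
  import Data.Rational as ℚ
  import Data.Rational.Properties as ℚ
  import Data.Rational.Unnormalised as ℚᵘ
  import Data.Rational.Unnormalised.Properties as ℚᵘ
  open import Data.Sum as Sum using (inj₁; inj₂)
  open import Data.Unit using (⊤; tt)
  open import Data.Vec as Vec using (Vec; []; _∷_; here; there; zipWith; replicate; lookup)
  open import Data.Vec.Properties using (∷-injective; ∷-injectiveʳ; ≡-dec)
  open import Function using (id; _∘_)
  open import Relation.Binary.PropositionalEquality
    using (_≡_; _≢_; refl; sym; trans; cong; cong₂; subst; subst₂; module ≡-Reasoning)
  open import Relation.Nullary using (¬_; Dec; yes; no; contradiction; ¬?; _×-dec_; _→-dec_; _because_)
  open import Relation.Nullary.Decidable using (from-yes; from-no; decidable-stable)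
  open import Relation.Unary using (Decidable)
  open import Algebra.Properties.CommutativeSemigroup *-commutativeSemigroup
    using () renaming (x∙yz≈y∙xz to *-exchange)
  open +-*-Solver using (solve; _:=_; _:+_; _:*_; con)

  private variable
    n k l r : ℕ
    X Y Z : Set

  -- Walks in the hypercube

  ∣─∣≡0⇒⊆ : (A B : Subset n) → ∣ A ─ B ∣ ≡ 0 → A ⊆ B
  ∣─∣≡0⇒⊆ [] [] _ ()
  ∣─∣≡0⇒⊆ (inside ∷ A)  (inside ∷ B)  eq = s⊆s (∣─∣≡0⇒⊆ A B eq)
  ∣─∣≡0⇒⊆ (outside ∷ A) (inside ∷ B)  eq = out⊆ (∣─∣≡0⇒⊆ A B eq)
  ∣─∣≡0⇒⊆ (outside ∷ A) (outside ∷ B) eq = s⊆s (∣─∣≡0⇒⊆ A B eq)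

  ⊆⇒∣─∣≡0 : (A B : Subset n) → A ⊆ B → ∣ A ─ B ∣ ≡ 0
  ⊆⇒∣─∣≡0 [] [] _ = refl
  ⊆⇒∣─∣≡0 (inside ∷ A)  (inside ∷ B)  p = ⊆⇒∣─∣≡0 A B (drop-∷-⊆ p)
  ⊆⇒∣─∣≡0 (inside ∷ A)  (outside ∷ B) p with () ← p here
  ⊆⇒∣─∣≡0 (outside ∷ A) (inside ∷ B)  p = ⊆⇒∣─∣≡0 A B (drop-∷-⊆ p)
  ⊆⇒∣─∣≡0 (outside ∷ A) (outside ∷ B) p = ⊆⇒∣─∣≡0 A B (drop-∷-⊆ p)

  ∣─∣-antisym : (A B : Subset n) → ∣ A ─ B ∣ ≡ 0 → ∣ B ─ A ∣ ≡ 0 → A ≡ B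
  ∣─∣-antisym [] [] _ _ = refl
  ∣─∣-antisym (inside ∷ A)  (inside ∷ B)  p q = cong (inside ∷_) (∣─∣-antisym A B p q)
  ∣─∣-antisym (outside ∷ A) (outside ∷ B) p q = cong (outside ∷_) (∣─∣-antisym A B p q)

  -- Both sides are the size of `A ∪ B`; the additive form avoids truncated subtraction.
  ∣A∣+∣B─A∣≡∣B∣+∣A─B∣ : (A B : Subset n) → ∣ A ∣ + ∣ B ─ A ∣ ≡ ∣ B ∣ + ∣ A ─ B ∣
  ∣A∣+∣B─A∣≡∣B∣+∣A─B∣ [] [] = refl
  ∣A∣+∣B─A∣≡∣B∣+∣A─B∣ (inside ∷ A)  (inside ∷ B)  = cong suc (∣A∣+∣B─A∣≡∣B∣+∣A─B∣ A B)
  ∣A∣+∣B─A∣≡∣B∣+∣A─B∣ (inside ∷ A)  (outside ∷ B) =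
    trans (cong suc (∣A∣+∣B─A∣≡∣B∣+∣A─B∣ A B)) (sym (+-suc ∣ B ∣ _))
  ∣A∣+∣B─A∣≡∣B∣+∣A─B∣ (outside ∷ A) (inside ∷ B)  =
    trans (+-suc ∣ A ∣ _) (cong suc (∣A∣+∣B─A∣≡∣B∣+∣A─B∣ A B))
  ∣A∣+∣B─A∣≡∣B∣+∣A─B∣ (outside ∷ A) (outside ∷ B) = ∣A∣+∣B─A∣≡∣B∣+∣A─B∣ A B

  ⊆⇒∣B─A∣≡k : (A B : Subset n) → ∣ A ─ B ∣ ≡ 0 → ∣ B ∣ ≡ k + ∣ A ∣ → ∣ B ─ A ∣ ≡ k
  ⊆⇒∣B─A∣≡k {k = k} A B A⊆B eq = +-cancelˡ-≡ ∣ A ∣ _ _ (begin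
    ∣ A ∣ + ∣ B ─ A ∣  ≡⟨ ∣A∣+∣B─A∣≡∣B∣+∣A─B∣ A B ⟩
    ∣ B ∣ + ∣ A ─ B ∣  ≡⟨ cong (∣ B ∣ +_) A⊆B ⟩
    ∣ B ∣ + 0          ≡⟨ +-identityʳ _ ⟩
    ∣ B ∣              ≡⟨ eq ⟩
    k + ∣ A ∣          ≡⟨ +-comm k _ ⟩
    ∣ A ∣ + k          ∎)
    where open ≡-Reasoning

  ∣△∣-split : (A B : Subset n) → ∣ A △ B ∣ ≡ ∣ A ─ B ∣ + ∣ B ─ A ∣
  ∣△∣-split [] [] = refl
  ∣△∣-split (inside ∷ A)  (inside ∷ B)  = ∣△∣-split A B
  ∣△∣-split (inside ∷ A)  (outside ∷ B) = cong suc (∣△∣-split A B)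
  ∣△∣-split (outside ∷ A) (inside ∷ B)  = trans (cong suc (∣△∣-split A B)) (sym (+-suc _ _))
  ∣△∣-split (outside ∷ A) (outside ∷ B) = ∣△∣-split A B

  ∣A△A∣≡0 : (A : Subset n) → ∣ A △ A ∣ ≡ 0
  ∣A△A∣≡0 []            = refl
  ∣A△A∣≡0 (inside  ∷ A) = ∣A△A∣≡0 A
  ∣A△A∣≡0 (outside ∷ A) = ∣A△A∣≡0 A

  suc-≤-+ : ∀ {m k l} → m ≤ k + l → suc m ≤ k + suc l
  suc-≤-+ {k = k} {l} m≤k+l = ≤-trans (s≤s m≤k+l) (≤-reflexive (sym (+-suc k l)))

  △-triangle : (A B C : Subset n) → ∣ A △ C ∣ ≤ ∣ A △ B ∣ + ∣ B △ C ∣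
  △-triangle [] [] [] = z≤n
  △-triangle (inside ∷ A)  (inside ∷ B)  (inside ∷ C)  = △-triangle A B C
  △-triangle (inside ∷ A)  (inside ∷ B)  (outside ∷ C) = suc-≤-+ (△-triangle A B C)
  △-triangle (inside ∷ A)  (outside ∷ B) (inside ∷ C)  =
    m≤n⇒m≤1+n (<⇒≤ (suc-≤-+ (△-triangle A B C)))
  △-triangle (inside ∷ A)  (outside ∷ B) (outside ∷ C) = s≤s (△-triangle A B C)
  △-triangle (outside ∷ A) (inside ∷ B)  (inside ∷ C)  = s≤s (△-triangle A B C)
  △-triangle (outside ∷ A) (inside ∷ B)  (outside ∷ C) =
    m≤n⇒m≤1+n (<⇒≤ (suc-≤-+ (△-triangle A B C)))
  △-triangle (outside ∷ A) (outside ∷ B) (inside ∷ C)  = suc-≤-+ (△-triangle A B C)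
  △-triangle (outside ∷ A) (outside ∷ B) (outside ∷ C) = △-triangle A B C

  △-sym : (A B : Subset n) → ∣ A △ B ∣ ≡ ∣ B △ A ∣
  △-sym A B = trans (∣△∣-split A B) (trans (+-comm ∣ A ─ B ∣ _) (sym (∣△∣-split B A)))

  -- A step towards `B`: when `∣ B ─ A ∣` is `suc k`, the fields `missing` and `excess` say that the
  -- added element lies in `B`.
  record Up (A B : Subset n) (k : ℕ) : Set where
    field
      next    : Subset n
      ⊆-next  : A ⊆ next
      adj     : ∣ A △ next ∣ ≡ 1
      size    : ∣ next ∣ ≡ suc ∣ A ∣
      missing : ∣ B ─ next ∣ ≡ k
      excess  : ∣ next ─ B ∣ ≡ ∣ A ─ B ∣

  up : (A B : Subset n) → ∣ B ─ A ∣ ≡ suc k → Up A B k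
  up [] [] ()
  up (outside ∷ A) (inside ∷ B) eq = record
    { next = inside ∷ A ; ⊆-next = out⊆ ⊆-refl ; adj = cong suc (∣A△A∣≡0 A)
    ; size = refl ; missing = suc-injective eq ; excess = refl }
  up (outside ∷ A) (outside ∷ B) eq = let open Up (up A B eq) in record
    { next = outside ∷ next ; ⊆-next = s⊆s ⊆-next ; adj = adj
    ; size = size ; missing = missing ; excess = excess }
  up (inside ∷ A) (inside ∷ B) eq = let open Up (up A B eq) in record
    { next = inside ∷ next ; ⊆-next = s⊆s ⊆-next ; adj = adj
    ; size = cong suc size ; missing = missing ; excess = excess }
  up (inside ∷ A) (outside ∷ B) eq = let open Up (up A B eq) in record
    { next = inside ∷ next ; ⊆-next = s⊆s ⊆-next ; adj = adj
    ; size = cong suc size ; missing = missing ; excess = cong suc excess }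

  record Down (A B : Subset n) (k : ℕ) : Set where
    field
      next    : Subset n
      adj     : ∣ A △ next ∣ ≡ 1
      size    : suc ∣ next ∣ ≡ ∣ A ∣
      excess  : ∣ next ─ B ∣ ≡ k
      missing : ∣ B ─ next ∣ ≡ ∣ B ─ A ∣

  down : (A B : Subset n) → ∣ A ─ B ∣ ≡ suc k → Down A B k
  down [] [] ()
  down (inside ∷ A) (outside ∷ B) eq = record
    { next = outside ∷ A ; adj = cong suc (∣A△A∣≡0 A)
    ; size = refl ; missing = refl ; excess = suc-injective eq }
  down (outside ∷ A) (outside ∷ B) eq = let open Down (down A B eq) in record
    { next = outside ∷ next ; adj = adj ; size = size ; missing = missing ; excess = excess }
  down (inside ∷ A) (inside ∷ B) eq = let open Down (down A B eq) in record
    { next = inside ∷ next ; adj = adj ; size = cong suc size ; missing = missing ; excess = excess }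
  down (outside ∷ A) (inside ∷ B) eq = let open Down (down A B eq) in record
    { next = outside ∷ next ; adj = adj ; size = size ; missing = cong suc missing ; excess = excess }

  -- `P` holds at every vertex, both endpoints included. Repeated vertices are allowed; they are
  -- excluded once the length equals the distance.
  data Walk (P : Subset n → Set) : Subset n → Subset n → ℕ → Set where
    stay   : ∀ {A} → P A → Walk P A A 0
    _∷⟨_⟩_ : ∀ {A B C k} → P A → ∣ A △ B ∣ ≡ 1 → Walk P B C k → Walk P A C (suc k)

  infixr 5 _∷⟨_⟩_

  module _ {P : Subset n → Set} where

    infixr 5 _++ʷ_

    _++ʷ_ : ∀ {A B C} → Walk P A B k → Walk P B C l → Walk P A C (k + l)
    stay _       ++ʷ w′ = w′
    (p ∷⟨ e ⟩ w) ++ʷ w′ = p ∷⟨ e ⟩ (w ++ʷ w′)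

    start : ∀ {A B} → Walk P A B k → P A
    start (stay p)          = p
    start (p ∷⟨ _ ⟩ _) = p

    reverseʷ : ∀ {A B} → Walk P A B k → Walk P B A k
    reverseʷ (stay p) = stay p
    reverseʷ {A = A} (_∷⟨_⟩_ {B = B} {k = k} p e w) = subst (Walk P _ A) (+-comm k 1)
      (reverseʷ w ++ʷ (start w ∷⟨ trans (△-sym B A) e ⟩ stay p))

    vertices : ∀ {A B} → Walk P A B k → List (Subset n)
    vertices {A = A} (stay p)          = A ∷ []
    vertices {A = A} (p ∷⟨ e ⟩ w) = A ∷ vertices w

    vertices-length : ∀ {A B} (w : Walk P A B k) → length (vertices w) ≡ suc k
    vertices-length (stay p)          = refl
    vertices-length (p ∷⟨ e ⟩ w) = cong suc (vertices-length w)

    vertices-All : ∀ {A B} (w : Walk P A B k) → All P (vertices w)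
    vertices-All (stay p)          = p ∷ []
    vertices-All (p ∷⟨ e ⟩ w) = p ∷ vertices-All w

    vertices-head : ∀ {A B} (w : Walk P A B k) → head (vertices w) ≡ just A
    vertices-head (stay p)          = refl
    vertices-head (p ∷⟨ e ⟩ w) = refl

    vertices-last : ∀ {A B} (w : Walk P A B k) → last (vertices w) ≡ just B
    vertices-last (stay p)                         = refl
    vertices-last (p ∷⟨ e ⟩ stay q)             = refl
    vertices-last (p ∷⟨ e ⟩ w@(_ ∷⟨ _ ⟩ _)) = vertices-last w

    vertices-Linked : ∀ {A B} (w : Walk P A B k) → Linked (λ A B → ∣ A △ B ∣ ≡ 1) (vertices w)
    vertices-Linked (stay p)                         = [-]
    vertices-Linked (p ∷⟨ e ⟩ stay q)             = e ∷ [-]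
    vertices-Linked (p ∷⟨ e ⟩ w@(_ ∷⟨ _ ⟩ _)) = e ∷ vertices-Linked w

    walk-length≥ : ∀ {A B} → Walk P A B k → ∣ A △ B ∣ ≤ k
    walk-length≥ {A = A} (stay _) = ≤-reflexive (∣A△A∣≡0 A)
    walk-length≥ {A = A} {C} (_∷⟨_⟩_ {B = B} p e w) =
      ≤-trans (△-triangle A B C) (+-mono-≤ (≤-reflexive e) (walk-length≥ w))

    vertices-near : ∀ {A B} (w : Walk P A B k) → All (λ C → ∣ C △ B ∣ ≤ k) (vertices w)
    vertices-near w@(stay p)          = walk-length≥ w ∷ []
    vertices-near w@(p ∷⟨ e ⟩ w′) = walk-length≥ w ∷ All.map m≤n⇒m≤1+n (vertices-near w′)

    -- The first vertex of a geodesic is farther from the end than every later one, so it cannot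
    -- recur.
    geodesic-distinct : ∀ {A B} (w : Walk P A B k) → ∣ A △ B ∣ ≡ k → Unique (vertices w)
    geodesic-distinct (stay p) _ = [] ∷ []
    geodesic-distinct {A = A} {C} (_∷⟨_⟩_ {B = B} {k = k} p e w) eq =
      All.map (λ C≤k A≡C → 1+n≰n (subst (_≤ k) (trans (cong (λ D → ∣ D △ C ∣) (sym A≡C)) eq) C≤k))
        (vertices-near w)
      -- By the triangle inequality the tail is again a geodesic.
      ∷ geodesic-distinct w (≤-antisym (walk-length≥ w)
          (s≤s⁻¹ (subst₂ _≤_ eq (cong (_+ ∣ B △ C ∣) e) (△-triangle A B C))))

  -- One edge changes the distance to `B` by at most one. The inequality is strict because `length`
  -- counts vertices, not edges.
  path-length> : ∀ {A B : Subset n} q → head q ≡ just A → last q ≡ just B →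
                 Linked (λ A B → ∣ A △ B ∣ ≡ 1) q → ∣ A △ B ∣ < length q
  path-length> {B = B} (A ∷ []) refl refl [-] = s≤s (≤-reflexive (∣A△A∣≡0 A))
  path-length> {B = C} (A ∷ B ∷ q) refl eq (e ∷ es) =
    s≤s (≤-trans (△-triangle A B C) (≤-trans (≤-reflexive (cong (_+ ∣ B △ C ∣) e))
      (path-length> (B ∷ q) refl eq es)))

  -- The length index is the distance, so the walk is free of repetitions and, by `path-length>`,
  -- shortest.
  geodesic⇒visible : ∀ {M : List (Subset n)} {A B} →
    Walk (λ C → ¬ (C ∈ˡ M × C ≢ A × C ≢ B)) A B ∣ A △ B ∣ → Visible (Q n) M A B
  geodesic⇒visible {M = M} {A} {B} w = vertices w ,
    ( mkIsPath (vertices-head w) (vertices-last w) (vertices-Linked w) (geodesic-distinct w refl)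
    , λ q (mkIsPath s e a _) → subst (_≤ length q) (sym (vertices-length w)) (path-length> q s e a)) ,
    vertices-All w

  -- Residues modulo 3 and routing through the empty layers

  next₃ : Fin 3 → Fin 3
  next₃ zero             = suc zero
  next₃ (suc zero)       = suc (suc zero)
  next₃ (suc (suc zero)) = zero

  next₃≢ : ∀ x → next₃ x ≢ x
  next₃≢ zero             ()
  next₃≢ (suc zero)       ()
  next₃≢ (suc (suc zero)) ()

  next₃²≢ : ∀ x → next₃ (next₃ x) ≢ x
  next₃²≢ zero             ()
  next₃²≢ (suc zero)       ()
  next₃²≢ (suc (suc zero)) ()

  next₃³ : ∀ x → next₃ (next₃ (next₃ x)) ≡ x
  next₃³ zero             = refl
  next₃³ (suc zero)       = refl
  next₃³ (suc (suc zero)) = refl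

  residue : ℕ → Fin 3
  residue zero    = zero
  residue (suc m) = next₃ (residue m)

  -- The members of `P` lie in layers of residue `a`, so two empty layers separate consecutive ones.
  -- The 5 in `detour` arises because a climb goes from residue `a` + 1 to residue `a`: its height
  -- is 2 modulo 3, hence 2 or at least 5.
  module Routing (P : Subset n → Set) (a : Fin 3)
    (layered : ∀ A → P A → residue ∣ A ∣ ≡ a)
    (detour  : ∀ C B → C ⊆ B → 5 + ∣ C ∣ ≤ ∣ B ∣ →
               ∃[ T ] C ⊆ T × T ⊆ B × ∣ T ∣ ≡ 2 + ∣ C ∣ × ¬ P T) where

    module _ {A B : Subset n} (PA : P A) (PB : P B) where

      Clear : Subset n → Set
      Clear C = ¬ (P C × C ≢ A × C ≢ B)

      private
        ¬P⇒clear : ∀ {C} → ¬ P C → Clear C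
        ¬P⇒clear ¬p (p , _) = ¬p p

        clear₁ : ∀ {C} → residue ∣ C ∣ ≡ next₃ a → Clear C
        clear₁ eq (p , _) = next₃≢ a (trans (sym eq) (layered _ p))

        clear₂ : ∀ {C} → residue ∣ C ∣ ≡ next₃ (next₃ a) → Clear C
        clear₂ eq (p , _) = next₃²≢ a (trans (sym eq) (layered _ p))

        residue-of-B : ∀ {m} → ∣ B ∣ ≡ m → residue m ≡ a
        residue-of-B refl = layered B PB

        clearA : Clear A
        clearA (_ , A≢A , _) = A≢A refl

        clearB : Clear B
        clearB (_ , _ , B≢B) = B≢B refl

      -- `C` and the intermediate vertex lie in the two empty layers below `T`, so only `T` itself
      -- has to be assumed clear.
      two-steps : ∀ {C T} → ∣ C ─ T ∣ ≡ 0 → ∣ T ∣ ≡ 2 + ∣ C ∣ → residue ∣ C ∣ ≡ next₃ a →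
                  Clear T → Walk Clear C T 2
      two-steps {C} {T} C⊆T eq res clearT =
        clear₁ res ∷⟨ U.adj ⟩
        clear₂ (trans (cong residue U.size) (cong next₃ res)) ∷⟨ V.adj ⟩
        subst (λ D → Walk Clear D T 0) (sym V≡T) (stay clearT)
        where
        module U = Up (up C T (⊆⇒∣B─A∣≡k C T C⊆T eq))
        module V = Up (up U.next T U.missing)
        V≡T : V.next ≡ T
        V≡T = ∣─∣-antisym _ _ (trans V.excess (trans U.excess C⊆T)) V.missing

      -- Two steps reach a non-member `T` in a layer of `P`, a third step leaves that layer, and `D`
      -- has residue `a` + 1 again. The walk is returned as a prefix operation so that `climb` can
      -- recurse from `D`.
      leap : ∀ k {C} → ∣ C ─ B ∣ ≡ 0 → ∣ B ∣ ≡ 5 + k + ∣ C ∣ → residue ∣ C ∣ ≡ next₃ a →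
             ∃[ D ] ∣ D ─ B ∣ ≡ 0 × ∣ B ∣ ≡ 2 + k + ∣ D ∣ × residue ∣ D ∣ ≡ next₃ a ×
               (∀ {l} → Walk Clear D B l → Walk Clear C B (3 + l))
      leap k {C} C⊆B eq res
        with T , C⊆T , T⊆B , ∣T∣ , ¬PT ←
          detour C B (∣─∣≡0⇒⊆ C B C⊆B)
            (subst (5 + ∣ C ∣ ≤_) (sym eq) (+-monoʳ-≤ 5 (m≤n+m ∣ C ∣ k))) =
        U.next , trans U.excess T⊆B′ , ∣B∣≡2+k+∣U∣ , trans (cong residue ∣U∣) (trans (next₃³ _) res) ,
        λ w → two-steps (⊆⇒∣─∣≡0 C T C⊆T) ∣T∣ res (¬P⇒clear ¬PT) ++ʷ ¬P⇒clear ¬PT ∷⟨ U.adj ⟩ w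
        where
        T⊆B′ : ∣ T ─ B ∣ ≡ 0
        T⊆B′ = ⊆⇒∣─∣≡0 T B T⊆B
        ∣B∣≡3+k+∣T∣ : ∣ B ∣ ≡ 3 + k + ∣ T ∣
        ∣B∣≡3+k+∣T∣ = trans eq (sym (trans (cong (3 + k +_) ∣T∣)
          (trans (+-suc (3 + k) _) (cong suc (+-suc (3 + k) _)))))
        module U = Up (up T B (⊆⇒∣B─A∣≡k T B T⊆B′ ∣B∣≡3+k+∣T∣))
        ∣U∣ : ∣ U.next ∣ ≡ 3 + ∣ C ∣
        ∣U∣ = trans U.size (cong suc ∣T∣)
        ∣B∣≡2+k+∣U∣ : ∣ B ∣ ≡ 2 + k + ∣ U.next ∣
        ∣B∣≡2+k+∣U∣ = trans ∣B∣≡3+k+∣T∣ (sym (trans (cong (2 + k +_) U.size) (+-suc (2 + k) _)))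

      climb : ∀ k {C} → ∣ C ─ B ∣ ≡ 0 → ∣ B ∣ ≡ k + ∣ C ∣ → residue ∣ C ∣ ≡ next₃ a → Walk Clear C B k
      -- Heights 0, 1, 3 and 4 contradict the residues of `C` and `B`, which force 2 modulo 3.
      climb 0 _ eq res =
        contradiction (trans (sym res) (residue-of-B eq)) (next₃≢ a)
      climb 1 _ eq res =
        contradiction (trans (sym (cong next₃ res)) (residue-of-B eq)) (next₃²≢ a)
      climb 2 C⊆B eq res = two-steps C⊆B eq res clearB
      climb 3 _ eq res =
        contradiction (trans (sym res) (trans (sym (next₃³ _)) (residue-of-B eq))) (next₃≢ a)
      climb 4 _ eq res = contradiction
        (trans (sym (cong next₃ res)) (trans (sym (next₃³ _)) (residue-of-B eq))) (next₃²≢ a)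
      climb (suc (suc (suc (suc (suc k))))) C⊆B eq res =
        let D , D⊆B , ∣B∣ , resD , extend = leap k C⊆B eq res
        in extend (climb (suc (suc k)) D⊆B ∣B∣ resD)

      -- `i` elements remain to be removed and `j` to be added. An addition followed by a removal
      -- stays within the two empty layers and lowers both counts by one.
      zigzag : ∀ i {j C} → ∣ C ─ B ∣ ≡ i → ∣ B ─ C ∣ ≡ j → ∣ C ∣ ≤ suc ∣ B ∣ →
               residue ∣ C ∣ ≡ next₃ a → Walk Clear C B (i + j)
      zigzag zero {j} {C} ex miss _ res = climb j ex ∣B∣≡ res
        where
        ∣B∣≡ : ∣ B ∣ ≡ j + ∣ C ∣
        ∣B∣≡ = begin
          ∣ B ∣              ≡⟨ +-identityʳ _ ⟨
          ∣ B ∣ + 0          ≡⟨ cong (∣ B ∣ +_) ex ⟨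
          ∣ B ∣ + ∣ C ─ B ∣  ≡⟨ ∣A∣+∣B─A∣≡∣B∣+∣A─B∣ C B ⟨
          ∣ C ∣ + ∣ B ─ C ∣  ≡⟨ cong (∣ C ∣ +_) miss ⟩
          ∣ C ∣ + j          ≡⟨ +-comm ∣ C ∣ j ⟩
          j + ∣ C ∣          ∎
          where open ≡-Reasoning
      zigzag (suc i) {suc j} {C} ex miss le res = subst (λ m → Walk Clear C B (suc m)) (sym (+-suc i j))
        (clear₁ res ∷⟨ U.adj ⟩
         clear₂ (trans (cong residue U.size) (cong next₃ res)) ∷⟨ D.adj ⟩
         zigzag i D.excess (trans D.missing U.missing) (subst (_≤ _) (sym ∣D∣) le)
           (trans (cong residue ∣D∣) res))
        where
        module U = Up (up C B miss)
        module D = Down (down U.next B (trans U.excess ex))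
        ∣D∣ : ∣ D.next ∣ ≡ ∣ C ∣
        ∣D∣ = suc-injective (trans D.size U.size)
      -- Now `B ⊆ C`, and the bound on `∣ C ∣` leaves exactly one surplus element; removing it lands
      -- on `B`.
      zigzag (suc i) {zero} {C} ex miss le res = clear₁ res ∷⟨ D.adj ⟩
        subst₂ (λ X m → Walk Clear X B (m + 0)) (sym D≡B) (sym i≡0) (stay clearB)
        where
        i≡0 : i ≡ 0
        i≡0 = n≤0⇒n≡0 (s≤s⁻¹ (+-cancelˡ-≤ ∣ B ∣ _ _ (begin
          ∣ B ∣ + suc i      ≡⟨ cong (∣ B ∣ +_) ex ⟨
          ∣ B ∣ + ∣ C ─ B ∣  ≡⟨ ∣A∣+∣B─A∣≡∣B∣+∣A─B∣ C B ⟨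
          ∣ C ∣ + ∣ B ─ C ∣  ≡⟨ cong (∣ C ∣ +_) miss ⟩
          ∣ C ∣ + 0          ≡⟨ +-identityʳ _ ⟩
          ∣ C ∣              ≤⟨ le ⟩
          suc ∣ B ∣          ≡⟨ +-comm 1 _ ⟩
          ∣ B ∣ + 1          ∎)))
          where open ≤-Reasoning
        module D = Down (down C B ex)
        D≡B : D.next ≡ B
        D≡B = ∣─∣-antisym _ _ (trans D.excess i≡0) (trans D.missing miss)

      route : ∣ A ∣ ≤ ∣ B ∣ → Walk Clear A B ∣ A △ B ∣
      route le with ∣ B ─ A ∣ in miss
      -- Nothing of `B` is missing and `A` is not larger than `B`, so the two coincide.
      ... | zero = subst (λ X → Walk Clear A X ∣ A △ X ∣) A≡B
        (subst (Walk Clear A A) (sym (∣A△A∣≡0 A)) (stay clearA))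
        where
        A≡B : A ≡ B
        A≡B = ∣─∣-antisym A B (n≤0⇒n≡0 (+-cancelˡ-≤ ∣ B ∣ _ _ (begin
          ∣ B ∣ + ∣ A ─ B ∣  ≡⟨ ∣A∣+∣B─A∣≡∣B∣+∣A─B∣ A B ⟨
          ∣ A ∣ + ∣ B ─ A ∣  ≡⟨ cong (∣ A ∣ +_) miss ⟩
          ∣ A ∣ + 0          ≤⟨ +-monoˡ-≤ 0 le ⟩
          ∣ B ∣ + 0          ∎))) miss
          where open ≤-Reasoning
      -- The first addition leads from the layer of `A` into the next, empty one; `le` supplies the
      -- size bound of `zigzag`.
      ... | suc j = subst (Walk Clear A B)
        (sym (trans (∣△∣-split A B) (trans (cong (∣ A ─ B ∣ +_) miss) (+-suc _ j))))
        (clearA ∷⟨ U.adj ⟩ zigzag ∣ A ─ B ∣ U.excess U.missing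
          (subst (_≤ _) (sym U.size) (s≤s le))
          (trans (cong residue U.size) (cong next₃ (layered A PA))))
        where
        module U = Up (up A B miss)

  -- Linear algebra over 𝔽₃

  lookup-injective : ∀ {xs : List X} → Unique xs → ∀ {i j} → List.lookup xs i ≡ List.lookup xs j → i ≡ j
  lookup-injective (_ ∷ _) {zero} {zero} _ = refl
  lookup-injective (x∉ ∷ _) {zero} {suc j} eq = contradiction eq (All.lookup x∉ (∈-lookup j))
  lookup-injective (x∉ ∷ _) {suc i} {zero} eq = contradiction (sym eq) (All.lookup x∉ (∈-lookup i))
  lookup-injective (_ ∷ u) {suc i} {suc j} eq = cong suc (lookup-injective u eq)

  -- Pigeonhole: each entry of `xs` is sent to a position of its image in `ys`. The list `ys` may
  -- contain repetitions.
  injectiveOn⇒length≤ : (f : X → Y) {xs : List X} {ys : List Y} → Unique xs →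
    (∀ {x y} → x ∈ˡ xs → y ∈ˡ xs → f x ≡ f y → x ≡ y) →
    (∀ {x} → x ∈ˡ xs → f x ∈ˡ ys) → length xs ≤ length ys
  injectiveOn⇒length≤ f {xs} {ys} u inj f∈ = injective⇒≤ {f = position} λ {i} {j} eq →
    lookup-injective u (inj (∈-lookup i) (∈-lookup j)
      (trans (lookup-index (f∈ (∈-lookup i)))
        (trans (cong (List.lookup ys) eq) (sym (lookup-index (f∈ (∈-lookup j)))))))
    where
    position : Fin (length xs) → Fin (length ys)
    position i = index (f∈ (∈-lookup i))

  length-cartesianProductWith : (f : X → Y → Z) (xs : List X) (ys : List Y) →
    length (cartesianProductWith f xs ys) ≡ length xs * length ys
  length-cartesianProductWith f []       ys = refl
  length-cartesianProductWith f (x ∷ xs) ys = trans (length-++ (map (f x) ys))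
    (cong₂ _+_ (length-map (f x) ys) (length-cartesianProductWith f xs ys))

  vectors : List X → ∀ n → List (Vec X n)
  vectors xs zero    = [ [] ]
  vectors xs (suc n) = cartesianProductWith _∷_ xs (vectors xs n)

  length-vectors : (xs : List X) (n : ℕ) → length (vectors xs n) ≡ length xs ^ n
  length-vectors xs zero    = refl
  length-vectors xs (suc n) = trans (length-cartesianProductWith _∷_ xs (vectors xs n))
    (cong (length xs *_) (length-vectors xs n))

  ∈-vectors : {xs : List X} → (∀ x → x ∈ˡ xs) → (v : Vec X n) → v ∈ˡ vectors xs n
  ∈-vectors all []      = here refl
  ∈-vectors all (x ∷ v) = ∈-cartesianProductWith⁺ _∷_ (all x) (∈-vectors all v)

  vectors-unique : {xs : List X} → Unique xs → ∀ n → Unique (vectors xs n)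
  vectors-unique u zero    = [] ∷ []
  vectors-unique u (suc n) = Unique.cartesianProductWith⁺ _∷_ ∷-injective u (vectors-unique u n)

  infixl 6 _+₃_
  infixl 7 _·₃_
  infix  8 -₃_

  _+₃_ : Fin 3 → Fin 3 → Fin 3
  zero         +₃ y = y
  suc zero     +₃ y = next₃ y
  suc (suc _)  +₃ y = next₃ (next₃ y)

  -₃_ : Fin 3 → Fin 3
  -₃ zero             = zero
  -₃ (suc zero)       = suc (suc zero)
  -₃ (suc (suc zero)) = suc zero

  _·₃_ : Fin 3 → Fin 3 → Fin 3
  zero             ·₃ y = zero
  suc zero         ·₃ y = y
  suc (suc zero)   ·₃ y = -₃ y

  𝔽₃^ : ℕ → Set
  𝔽₃^ = Vec (Fin 3)

  infixl 6 _⊕_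
  infixr 7 _•_
  infix  8 ⊖_

  𝟘 : 𝔽₃^ r
  𝟘 = replicate _ zero

  _⊕_ : 𝔽₃^ r → 𝔽₃^ r → 𝔽₃^ r
  _⊕_ = zipWith _+₃_

  ⊖_ : 𝔽₃^ r → 𝔽₃^ r
  ⊖_ = Vec.map -₃_

  _•_ : Fin 3 → 𝔽₃^ r → 𝔽₃^ r
  c • v = Vec.map (c ·₃_) v

  0•⊕ : (v x : 𝔽₃^ r) → zero • v ⊕ x ≡ x
  0•⊕ []      []      = refl
  0•⊕ (_ ∷ v) (b ∷ x) = cong (b ∷_) (0•⊕ v x)

  -- Removes a term with coefficient 1. As in the identities that follow, the scalar case is settled
  -- by evaluation on all of `Fin 3`.
  ⊖⊕-cancel : (v x : 𝔽₃^ r) → ⊖ v ⊕ (suc zero • v ⊕ x) ≡ x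
  ⊖⊕-cancel [] [] = refl
  ⊖⊕-cancel (a ∷ v) (b ∷ x) = cong₂ _∷_
    (from-yes (allFin? λ a → allFin? λ b → (-₃ a +₃ (a +₃ b)) Fin.≟ b) a b) (⊖⊕-cancel v x)

  ⊕⊖-cancel : (v x : 𝔽₃^ r) → v ⊕ (suc (suc zero) • v ⊕ x) ≡ x
  ⊕⊖-cancel [] [] = refl
  ⊕⊖-cancel (a ∷ v) (b ∷ x) = cong₂ _∷_
    (from-yes (allFin? λ a → allFin? λ b → (a +₃ (-₃ a +₃ b)) Fin.≟ b) a b) (⊕⊖-cancel v x)

  1•⊕𝟘 : (v : 𝔽₃^ r) → suc zero • v ⊕ 𝟘 ≡ v
  1•⊕𝟘 []      = refl
  1•⊕𝟘 (a ∷ v) = cong₂ _∷_ (from-yes (allFin? λ a → (a +₃ zero) Fin.≟ a) a) (1•⊕𝟘 v)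

  ⊖[2•⊕𝟘] : (v : 𝔽₃^ r) → ⊖ (suc (suc zero) • v ⊕ 𝟘) ≡ v
  ⊖[2•⊕𝟘] []      = refl
  ⊖[2•⊕𝟘] (a ∷ v) = cong₂ _∷_
    (from-yes (allFin? λ a → (-₃ (-₃ a +₃ zero)) Fin.≟ a) a) (⊖[2•⊕𝟘] v)

  ⊖-distrib-⊕ : (v x : 𝔽₃^ r) → ⊖ (v ⊕ x) ≡ ⊖ v ⊕ ⊖ x
  ⊖-distrib-⊕ []      []      = refl
  ⊖-distrib-⊕ (a ∷ v) (b ∷ x) = cong₂ _∷_
    (from-yes (allFin? λ a → allFin? λ b → (-₃ (a +₃ b)) Fin.≟ (-₃ a +₃ -₃ b)) a b) (⊖-distrib-⊕ v x)

  ⊖-involutive : (v : 𝔽₃^ r) → ⊖ ⊖ v ≡ v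
  ⊖-involutive []      = refl
  ⊖-involutive (a ∷ v) = cong₂ _∷_
    (from-yes (allFin? λ a → (-₃ -₃ a) Fin.≟ a) a) (⊖-involutive v)

  ⊕-inverseʳ : (v : 𝔽₃^ r) → v ⊕ ⊖ v ≡ 𝟘
  ⊕-inverseʳ []      = refl
  ⊕-inverseʳ (a ∷ v) = cong₂ _∷_
    (from-yes (allFin? λ a → (a +₃ -₃ a) Fin.≟ zero) a) (⊕-inverseʳ v)

  ⊕⊖≡𝟘⇒≡ : (v x : 𝔽₃^ r) → v ⊕ ⊖ x ≡ 𝟘 → v ≡ x
  ⊕⊖≡𝟘⇒≡ []      []      _  = refl
  ⊕⊖≡𝟘⇒≡ (a ∷ v) (b ∷ x) eq with eq₀ , eqs ← ∷-injective eq = cong₂ _∷_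
    (from-yes (allFin? λ a → allFin? λ b → ((a +₃ -₃ b) Fin.≟ zero) →-dec (a Fin.≟ b)) a b eq₀)
    (⊕⊖≡𝟘⇒≡ v x eqs)

  •-⊕-interchange : (c d : Fin 3) (v x y : 𝔽₃^ r) →
    (c +₃ -₃ d) • v ⊕ (x ⊕ ⊖ y) ≡ (c • v ⊕ x) ⊕ ⊖ (d • v ⊕ y)
  •-⊕-interchange c d []      []      []      = refl
  •-⊕-interchange c d (a ∷ v) (b ∷ x) (b′ ∷ y) = cong₂ _∷_
    (from-yes (allFin? λ c → allFin? λ d → allFin? λ a → allFin? λ b → allFin? λ b′ →
      ((c +₃ -₃ d) ·₃ a +₃ (b +₃ -₃ b′)) Fin.≟ ((c ·₃ a +₃ b) +₃ -₃ (d ·₃ a +₃ b′))) c d a b b′)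
    (•-⊕-interchange c d v x y)

  comb : Vec (Fin 3) n → Vec (𝔽₃^ r) n → 𝔽₃^ r
  comb []       []       = 𝟘
  comb (c ∷ cs) (v ∷ vs) = c • v ⊕ comb cs vs

  comb-𝟘 : (vs : Vec (𝔽₃^ r) n) → comb 𝟘 vs ≡ 𝟘
  comb-𝟘 []       = refl
  comb-𝟘 (v ∷ vs) = trans (0•⊕ v _) (comb-𝟘 vs)

  comb-⊖ : (c d : Vec (Fin 3) n) (vs : Vec (𝔽₃^ r) n) → comb (c ⊕ ⊖ d) vs ≡ comb c vs ⊕ ⊖ comb d vs
  comb-⊖ []      []      []       = sym (⊕-inverseʳ 𝟘)
  comb-⊖ (c ∷ cs) (d ∷ ds) (v ∷ vs) =
    trans (cong ((c +₃ -₃ d) • v ⊕_) (comb-⊖ cs ds vs)) (•-⊕-interchange c d v _ _)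

  Supported : Vec (Fin 3) n → Subset n → Set
  Supported c T = ∀ i → lookup c i ≢ zero → i ∈ T

  -- Coefficients are indexed by all of [n] and restricted by their support, so that combinations
  -- over different index sets can be subtracted.
  Independent : Vec (𝔽₃^ r) n → Subset n → Set
  Independent vs T = ∀ c → Supported c T → comb c vs ≡ 𝟘 → c ≡ 𝟘

  supported-tail : ∀ {c b} {cs : Vec (Fin 3) n} {T} → Supported (c ∷ cs) (b ∷ T) → Supported cs T
  supported-tail s i c≢0 = drop-there (s (suc i) c≢0)

  supported-mono : ∀ (c : Vec (Fin 3) n) {S T} → S ⊆ T → Supported c S → Supported c T
  supported-mono c S⊆T s i c≢0 = S⊆T (s i c≢0)

  supported-⊖ : ∀ (c d : Vec (Fin 3) n) {T} → Supported c T → Supported d T → Supported (c ⊕ ⊖ d) T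
  supported-⊖ (zero ∷ c) (zero ∷ d) s t zero ≢0 = contradiction refl ≢0
  supported-⊖ (suc _ ∷ c) (d ∷ ds) s t zero ≢0 = s zero λ ()
  supported-⊖ (zero ∷ c) (suc _ ∷ d) s t zero ≢0 = t zero λ ()
  supported-⊖ (_ ∷ c) (_ ∷ d) {_ ∷ T} s t (suc i) ≢0 =
    there (supported-⊖ c d (supported-tail s) (supported-tail t) i ≢0)

  _∈?_ : (v : 𝔽₃^ r) (L : List (𝔽₃^ r)) → Dec (v ∈ˡ L)
  _∈?_ = DecPropositional._∈?_ (≡-dec Fin._≟_)

  -- The three translates of `L` by multiples of `v` are concatenated without removing duplicates,
  -- so the length triples exactly.
  adjoin : 𝔽₃^ r → List (𝔽₃^ r) → List (𝔽₃^ r)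
  adjoin v L = L ++ map (v ⊕_) L ++ map (⊖ v ⊕_) L

  -- The vectors selected by A are added one at a time, and L lists the span of
  -- those already chosen.
  Extends : List (𝔽₃^ r) → Vec (𝔽₃^ r) n → Subset n → Set
  Extends L []       []            = ⊤
  Extends L (v ∷ vs) (outside ∷ A) = Extends L vs A
  Extends L (v ∷ vs) (inside ∷ A)  = v ∉ L × Extends (adjoin v L) vs A

  extends? : (L : List (𝔽₃^ r)) (vs : Vec (𝔽₃^ r) n) (A : Subset n) → Dec (Extends L vs A)
  extends? L []       []            = yes tt
  extends? L (v ∷ vs) (outside ∷ A) = extends? L vs A
  extends? L (v ∷ vs) (inside ∷ A)  = ¬? (v ∈? L) ×-dec extends? (adjoin v L) vs A

  ⊖-Closed : List (𝔽₃^ r) → Set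
  ⊖-Closed L = ∀ {v} → v ∈ˡ L → ⊖ v ∈ˡ L

  ∈-adjoin⁺ : ∀ (v : 𝔽₃^ r) {x} L → x ∈ˡ L → v ⊕ x ∈ˡ adjoin v L
  ∈-adjoin⁺ v L x∈ = ∈-++⁺ʳ L (∈-++⁺ˡ (∈-map⁺ (v ⊕_) x∈))

  ∈-adjoin⁻ : ∀ (v : 𝔽₃^ r) {x} L → x ∈ˡ L → ⊖ v ⊕ x ∈ˡ adjoin v L
  ∈-adjoin⁻ v L x∈ = ∈-++⁺ʳ L (∈-++⁺ʳ (map (v ⊕_) L) (∈-map⁺ (⊖ v ⊕_) x∈))

  adjoin-closed : (v : 𝔽₃^ r) {L : List (𝔽₃^ r)} → ⊖-Closed L → ⊖-Closed (adjoin v L)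
  adjoin-closed v {L} closed x∈ with ∈-++⁻ L x∈
  ... | inj₁ x∈L = ∈-++⁺ˡ (closed x∈L)
  ... | inj₂ x∈′ with ∈-++⁻ (map (v ⊕_) L) x∈′
  ...   | inj₁ x∈+ with y , y∈ , refl ← ∈-map⁻ (v ⊕_) x∈+ =
    subst (_∈ˡ adjoin v L) (sym (⊖-distrib-⊕ v y)) (∈-adjoin⁻ v L (closed y∈))
  ...   | inj₂ x∈- with y , y∈ , refl ← ∈-map⁻ (⊖ v ⊕_) x∈- =
    subst (_∈ˡ adjoin v L)
      (sym (trans (⊖-distrib-⊕ (⊖ v) y) (cong (_⊕ ⊖ y) (⊖-involutive v))))
      (∈-adjoin⁺ v L (closed y∈))

  -- Membership in `L`, in place of vanishing, is what the induction needs. If the coefficient of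
  -- `v` is nonzero, subtracting its term puts the rest of the combination into `adjoin v L`. By
  -- induction the rest is trivial, so `v` or its negative lies in `L`, and `⊖-Closed` yields the
  -- contradiction.
  extends⇒trivial : ∀ {L : List (𝔽₃^ r)} → ⊖-Closed L → ∀ vs (A : Subset n) → Extends L vs A →
    ∀ c → Supported c A → comb c vs ∈ˡ L → c ≡ 𝟘
  extends⇒trivial closed [] [] _ [] _ _ = refl
  extends⇒trivial closed (v ∷ vs) (outside ∷ A) e (zero ∷ c) s x∈ = cong (zero ∷_)
    (extends⇒trivial closed vs A e c (supported-tail s) (subst (_∈ˡ _) (0•⊕ v _) x∈))
  extends⇒trivial closed (v ∷ vs) (outside ∷ A) e (suc _ ∷ c) s x∈ with () ← s zero (λ ())
  extends⇒trivial {L = L} closed (v ∷ vs) (inside ∷ A) (v∉L , e) (a ∷ c) s = go a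
    where
    trivial : comb c vs ∈ˡ adjoin v L → c ≡ 𝟘
    trivial = extends⇒trivial (adjoin-closed v closed) vs A e c (supported-tail s)

    comb≡𝟘 : c ≡ 𝟘 → comb c vs ≡ 𝟘
    comb≡𝟘 refl = comb-𝟘 vs

    go : ∀ a → a • v ⊕ comb c vs ∈ˡ L → a ∷ c ≡ 𝟘
    go zero x∈ = cong (zero ∷_) (trivial (∈-++⁺ˡ (subst (_∈ˡ L) (0•⊕ v _) x∈)))
    go (suc zero) x∈ = contradiction
      (subst (_∈ˡ L) (trans (cong (suc zero • v ⊕_) (comb≡𝟘 (trivial
        (subst (_∈ˡ adjoin v L) (⊖⊕-cancel v _) (∈-adjoin⁻ v L x∈))))) (1•⊕𝟘 v)) x∈)
      v∉L
    go (suc (suc zero)) x∈ = contradiction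
      (subst (_∈ˡ L) (trans (cong (λ y → ⊖ (suc (suc zero) • v ⊕ y)) (comb≡𝟘 (trivial
        (subst (_∈ˡ adjoin v L) (⊕⊖-cancel v _) (∈-adjoin⁺ v L x∈))))) (⊖[2•⊕𝟘] v)) (closed x∈))
      v∉L

  extends⇒independent : ∀ vs (A : Subset n) → Extends {r} [ 𝟘 ] vs A → Independent vs A
  extends⇒independent vs A e c s eq = extends⇒trivial closed vs A e c s (here eq)
    where
    ⊖𝟘 : ∀ r → ⊖ 𝟘 {r} ≡ 𝟘
    ⊖𝟘 zero    = refl
    ⊖𝟘 (suc r) = cong (zero ∷_) (⊖𝟘 r)
    closed : ⊖-Closed [ 𝟘 {r} ]
    closed (here refl) = here (⊖𝟘 _)

  -- At most four directions in a plane over 𝔽₃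

  ∣∪∣+∣∩∣ : (S T : Subset n) → ∣ S ∪ T ∣ + ∣ S ∩ T ∣ ≡ ∣ S ∣ + ∣ T ∣
  ∣∪∣+∣∩∣ [] [] = refl
  ∣∪∣+∣∩∣ (inside ∷ S)  (inside ∷ T)  = cong suc (trans (+-suc ∣ S ∪ T ∣ _)
    (trans (cong suc (∣∪∣+∣∩∣ S T)) (sym (+-suc ∣ S ∣ _))))
  ∣∪∣+∣∩∣ (inside ∷ S)  (outside ∷ T) = cong suc (∣∪∣+∣∩∣ S T)
  ∣∪∣+∣∩∣ (outside ∷ S) (inside ∷ T)  = trans (cong suc (∣∪∣+∣∩∣ S T)) (sym (+-suc ∣ S ∣ _))
  ∣∪∣+∣∩∣ (outside ∷ S) (outside ∷ T) = ∣∪∣+∣∩∣ S T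

  enlarge : ∀ k (T B : Subset n) → T ⊆ B → k + ∣ T ∣ ≤ ∣ B ∣ →
            ∃[ T′ ] T ⊆ T′ × T′ ⊆ B × ∣ T′ ∣ ≡ k + ∣ T ∣
  enlarge zero    T B T⊆B _  = T , ⊆-refl , T⊆B , refl
  enlarge (suc k) T B T⊆B le =
    let T′ , U⊆T′ , T′⊆B , eq = enlarge k U.next B U⊆B
          (subst (_≤ ∣ B ∣) (sym (trans (cong (k +_) U.size) (+-suc k _))) le)
    in T′ , ⊆-trans U.⊆-next U⊆T′ , T′⊆B , trans eq (trans (cong (k +_) U.size) (+-suc k _))
    where
    d = ∣ B ∣ ∸ suc ∣ T ∣
    ∣B∣≡ : ∣ B ∣ ≡ suc d + ∣ T ∣
    ∣B∣≡ = sym (trans (sym (+-suc d _)) (m∸n+n≡m (≤-trans (s≤s (m≤n+m ∣ T ∣ k)) le)))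
    module U = Up (up T B (⊆⇒∣B─A∣≡k T B (⊆⇒∣─∣≡0 T B T⊆B) ∣B∣≡))
    U⊆B : U.next ⊆ B
    U⊆B = ∣─∣≡0⇒⊆ U.next B (trans U.excess (⊆⇒∣─∣≡0 T B T⊆B))

  supportedOn : Subset n → List (Vec (Fin 3) n)
  supportedOn []            = [ [] ]
  supportedOn (inside ∷ S)  = cartesianProductWith _∷_ (allFin 3) (supportedOn S)
  supportedOn (outside ∷ S) = map (zero ∷_) (supportedOn S)

  units : List (Fin 3)
  units = suc zero ∷ suc (suc zero) ∷ []

  -- The coefficient vectors supported on B with at most one nonzero entry outside S.
  star : Subset n → Subset n → List (Vec (Fin 3) n)
  star []            []            = [ [] ]
  star (inside ∷ S)  (_ ∷ B)       = cartesianProductWith _∷_ (allFin 3) (star S B)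
  star (outside ∷ S) (outside ∷ B) = map (zero ∷_) (star S B)
  star (outside ∷ S) (inside ∷ B)  =
    map (zero ∷_) (star S B) ++ cartesianProductWith _∷_ units (supportedOn S)

  length-supportedOn : (S : Subset n) → length (supportedOn S) ≡ 3 ^ ∣ S ∣
  length-supportedOn []            = refl
  length-supportedOn (inside ∷ S)  = trans (length-cartesianProductWith _∷_ (allFin 3) (supportedOn S))
    (cong (3 *_) (length-supportedOn S))
  length-supportedOn (outside ∷ S) = trans (length-map (zero ∷_) (supportedOn S)) (length-supportedOn S)

  -- There is one block of size `3 ^ ∣ S ∣` for the vectors supported on `S`, and two for each
  -- element of `B ─ S`, one per nonzero value of its coefficient.
  length-star : (S B : Subset n) → length (star S B) ≡ (1 + 2 * ∣ B ─ S ∣) * 3 ^ ∣ S ∣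
  length-star []            []            = refl
  length-star (inside ∷ S)  (b ∷ B)       = begin
    length (star (inside ∷ S) (b ∷ B))
      ≡⟨ length-cartesianProductWith _∷_ (allFin 3) (star S B) ⟩
    3 * length (star S B)                    ≡⟨ cong (3 *_) (length-star S B) ⟩
    3 * ((1 + 2 * ∣ B ─ S ∣) * 3 ^ ∣ S ∣)    ≡⟨ solve 2 (λ d p →
      con 3 :* (d :* p) := d :* (con 3 :* p)) refl (1 + 2 * ∣ B ─ S ∣) (3 ^ ∣ S ∣) ⟩
    (1 + 2 * ∣ B ─ S ∣) * (3 * 3 ^ ∣ S ∣)
      ≡⟨ cong (λ d → (1 + 2 * d) * (3 * 3 ^ ∣ S ∣)) (─-inside b) ⟨
    (1 + 2 * ∣ (b ∷ B) ─ (inside ∷ S) ∣) * (3 * 3 ^ ∣ S ∣) ∎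
    where
    open ≡-Reasoning
    ─-inside : ∀ b → ∣ (b ∷ B) ─ (inside ∷ S) ∣ ≡ ∣ B ─ S ∣
    ─-inside inside  = refl
    ─-inside outside = refl
  length-star (outside ∷ S) (outside ∷ B) = trans (length-map (zero ∷_) (star S B)) (length-star S B)
  length-star (outside ∷ S) (inside ∷ B)  = begin
    length (map (zero ∷_) (star S B) ++ cartesianProductWith _∷_ units (supportedOn S))
      ≡⟨ length-++ (map (zero ∷_) (star S B)) ⟩
    length (map (zero ∷_) (star S B)) + length (cartesianProductWith _∷_ units (supportedOn S))
      ≡⟨ cong₂ _+_ (trans (length-map (zero ∷_) (star S B)) (length-star S B))
           (trans (length-cartesianProductWith _∷_ units (supportedOn S))
             (cong (2 *_) (length-supportedOn S))) ⟩
    (1 + 2 * ∣ B ─ S ∣) * 3 ^ ∣ S ∣ + 2 * 3 ^ ∣ S ∣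
      ≡⟨ solve 2 (λ d p → (con 1 :+ con 2 :* d) :* p :+ con 2 :* p :=
           (con 1 :+ con 2 :* (con 1 :+ d)) :* p) refl ∣ B ─ S ∣ (3 ^ ∣ S ∣) ⟩
    (1 + 2 * suc ∣ B ─ S ∣) * 3 ^ ∣ S ∣  ∎
    where
    open ≡-Reasoning

  supportedOn-unique : (S : Subset n) → Unique (supportedOn S)
  supportedOn-unique []            = [] ∷ []
  supportedOn-unique (inside ∷ S)  =
    Unique.cartesianProductWith⁺ _∷_ ∷-injective (Unique.allFin⁺ 3) (supportedOn-unique S)
  supportedOn-unique (outside ∷ S) = Unique.map⁺ ∷-injectiveʳ (supportedOn-unique S)

  star-unique : (S B : Subset n) → Unique (star S B)
  star-unique []            []            = [] ∷ []
  star-unique (inside ∷ S)  (_ ∷ B)       =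
    Unique.cartesianProductWith⁺ _∷_ ∷-injective (Unique.allFin⁺ 3) (star-unique S B)
  star-unique (outside ∷ S) (outside ∷ B) = Unique.map⁺ ∷-injectiveʳ (star-unique S B)
  star-unique (outside ∷ S) (inside ∷ B)  =
    Unique.++⁺ (Unique.map⁺ ∷-injectiveʳ (star-unique S B))
      (Unique.cartesianProductWith⁺ _∷_ ∷-injective (((λ ()) ∷ []) ∷ [] ∷ []) (supportedOn-unique S))
      λ (∈₀ , ∈±) → disjoint ∈₀ ∈±
    where
    disjoint : ∀ {w} → w ∈ˡ map (zero ∷_) (star S B) →
               w ∉ cartesianProductWith _∷_ units (supportedOn S)
    disjoint ∈₀ ∈± with _ , _ , refl ← ∈-map⁻ (zero ∷_) ∈₀
      with ∈-cartesianProductWith⁻ _∷_ units (supportedOn S) ∈±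
    ... | _ , _ , here refl , _ , ()
    ... | _ , _ , there (here refl) , _ , ()

  supported-∷-inside : ∀ {c} {cs : Vec (Fin 3) n} {T} → Supported cs T → Supported (c ∷ cs) (inside ∷ T)
  supported-∷-inside s zero    _  = here
  supported-∷-inside s (suc i) ≢0 = there (s i ≢0)

  supported-0∷ : ∀ {b} {cs : Vec (Fin 3) n} {T} → Supported cs T → Supported (zero ∷ cs) (b ∷ T)
  supported-0∷ s zero    ≢0 = contradiction refl ≢0
  supported-0∷ s (suc i) ≢0 = there (s i ≢0)

  supportedOn-sound : (S : Subset n) → ∀ {w} → w ∈ˡ supportedOn S → Supported w S
  supportedOn-sound [] _ ()
  supportedOn-sound (inside ∷ S) w∈
    with _ , _ , _ , w∈′ , refl ← ∈-cartesianProductWith⁻ _∷_ (allFin 3) (supportedOn S) w∈ =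
    supported-∷-inside (supportedOn-sound S w∈′)
  supportedOn-sound (outside ∷ S) w∈ with _ , w∈′ , refl ← ∈-map⁻ (zero ∷_) w∈ =
    supported-0∷ (supportedOn-sound S w∈′)

  -- `T` is `S` with at most one element of `B` added. `no-five-arc` relies on the union of two such
  -- sets having at most `2 + ∣ S ∣` elements.
  star-sound : (S B : Subset n) → S ⊆ B → ∀ {w} → w ∈ˡ star S B →
               ∃[ T ] S ⊆ T × T ⊆ B × ∣ T ∣ ≤ suc ∣ S ∣ × Supported w T
  star-sound [] [] _ _ = [] , ⊆-refl , ⊆-refl , z≤n , λ ()
  star-sound (inside ∷ S) (outside ∷ B) S⊆B _ with () ← S⊆B here
  star-sound (inside ∷ S) (inside ∷ B) S⊆B w∈
    with _ , _ , _ , w∈′ , refl ← ∈-cartesianProductWith⁻ _∷_ (allFin 3) (star S B) w∈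
    with T , S⊆T , T⊆B , le , s ← star-sound S B (drop-∷-⊆ S⊆B) w∈′ =
    inside ∷ T , s⊆s S⊆T , s⊆s T⊆B , s≤s le , supported-∷-inside s
  star-sound (outside ∷ S) (outside ∷ B) S⊆B w∈
    with _ , w∈′ , refl ← ∈-map⁻ (zero ∷_) w∈
    with T , S⊆T , T⊆B , le , s ← star-sound S B (drop-∷-⊆ S⊆B) w∈′ =
    outside ∷ T , s⊆s S⊆T , s⊆s T⊆B , le , supported-0∷ s
  star-sound (outside ∷ S) (inside ∷ B) S⊆B w∈ with ∈-++⁻ (map (zero ∷_) (star S B)) w∈
  ... | inj₁ w∈₀ with _ , w∈′ , refl ← ∈-map⁻ (zero ∷_) w∈₀
      with T , S⊆T , T⊆B , le , s ← star-sound S B (drop-∷-⊆ S⊆B) w∈′ =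
    outside ∷ T , s⊆s S⊆T , out⊆ T⊆B , le , supported-0∷ s
  ... | inj₂ w∈±
      with _ , _ , _ , w∈′ , refl ← ∈-cartesianProductWith⁻ _∷_ units (supportedOn S) w∈± =
    inside ∷ S , out⊆ ⊆-refl , s⊆s (drop-∷-⊆ S⊆B) , ≤-refl , supported-∷-inside (supportedOn-sound S w∈′)

  -- If every pair extended S independently, the eleven cosets of span S
  -- represented by 0 and ± the five vectors would be distinct, but there are
  -- only nine cosets.
  no-five-arc : (S B : Subset n) (vs : Vec (𝔽₃^ (2 + ∣ S ∣)) n) → S ⊆ B → 5 + ∣ S ∣ ≤ ∣ B ∣ →
    ¬ (∀ T → S ⊆ T → T ⊆ B → ∣ T ∣ ≡ 2 + ∣ S ∣ → Independent vs T)
  no-five-arc S B vs S⊆B 5+∣S∣≤∣B∣ indep = <⇒≱ 9<11 (begin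
    11 * 3 ^ ∣ S ∣                     ≤⟨ *-monoˡ-≤ (3 ^ ∣ S ∣) (s≤s (*-monoʳ-≤ 2 5≤∣B─S∣)) ⟩
    (1 + 2 * ∣ B ─ S ∣) * 3 ^ ∣ S ∣    ≡⟨ length-star S B ⟨
    length (star S B)                  ≤⟨ injectiveOn⇒length≤ (λ w → comb w vs) (star-unique S B) injective
                                            (λ _ → ∈-vectors ∈-allFin _) ⟩
    length (vectors (allFin 3) (2 + ∣ S ∣)) ≡⟨ length-vectors (allFin 3) (2 + ∣ S ∣) ⟩
    3 ^ (2 + ∣ S ∣)                    ≡⟨ *-assoc 3 3 (3 ^ ∣ S ∣) ⟨
    9 * 3 ^ ∣ S ∣                      ∎)
    where
    open ≤-Reasoning
    9<11 : 9 * 3 ^ ∣ S ∣ < 11 * 3 ^ ∣ S ∣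
    9<11 = *-monoˡ-< (3 ^ ∣ S ∣) {{m^n≢0 3 ∣ S ∣}} (from-yes (9 <? 11))

    5≤∣B─S∣ : 5 ≤ ∣ B ─ S ∣
    5≤∣B─S∣ = +-cancelʳ-≤ ∣ S ∣ _ _ (begin
      5 + ∣ S ∣          ≤⟨ 5+∣S∣≤∣B∣ ⟩
      ∣ B ∣              ≤⟨ m≤m+n _ _ ⟩
      ∣ B ∣ + ∣ S ─ B ∣  ≡⟨ ∣A∣+∣B─A∣≡∣B∣+∣A─B∣ S B ⟨
      ∣ S ∣ + ∣ B ─ S ∣  ≡⟨ +-comm ∣ S ∣ _ ⟩
      ∣ B ─ S ∣ + ∣ S ∣  ∎)

    -- The hypothesis concerns sets of size exactly `2 + ∣ S ∣`; a smaller set inherits independence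
    -- from an enlargement inside `B`.
    independent : ∀ T → S ⊆ T → T ⊆ B → ∣ T ∣ ≤ 2 + ∣ S ∣ → Independent vs T
    independent T S⊆T T⊆B le c s =
      let eq = m∸n+n≡m le
          T′ , T⊆T′ , T′⊆B , eq′ = enlarge (2 + ∣ S ∣ ∸ ∣ T ∣) T B T⊆B
            (≤-trans (≤-reflexive eq) (≤-trans (m≤n+m (2 + ∣ S ∣) 3) 5+∣S∣≤∣B∣))
      in indep T′ (⊆-trans S⊆T T⊆T′) T′⊆B (trans eq′ eq) c (supported-mono c T⊆T′ s)

    injective : ∀ {w w′} → w ∈ˡ star S B → w′ ∈ˡ star S B → comb w vs ≡ comb w′ vs → w ≡ w′
    injective {w} {w′} w∈ w′∈ eq =
      let T , S⊆T , T⊆B , le , s = star-sound S B S⊆B w∈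
          T′ , S⊆T′ , T′⊆B , le′ , s′ = star-sound S B S⊆B w′∈
          -- Both sets contain `S`, so in inclusion-exclusion the intersection takes away at least
          -- `∣ S ∣`.
          ∪≤ : ∣ T ∪ T′ ∣ ≤ 2 + ∣ S ∣
          ∪≤ = +-cancelʳ-≤ ∣ S ∣ _ _ (begin
            ∣ T ∪ T′ ∣ + ∣ S ∣         ≤⟨ +-monoʳ-≤ ∣ T ∪ T′ ∣
                                            (p⊆q⇒∣p∣≤∣q∣ λ i∈S → x∈p∩q⁺ (S⊆T i∈S , S⊆T′ i∈S)) ⟩
            ∣ T ∪ T′ ∣ + ∣ T ∩ T′ ∣    ≡⟨ ∣∪∣+∣∩∣ T T′ ⟩
            ∣ T ∣ + ∣ T′ ∣             ≤⟨ +-mono-≤ le le′ ⟩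
            suc ∣ S ∣ + suc ∣ S ∣      ≡⟨ +-suc (suc ∣ S ∣) ∣ S ∣ ⟩
            2 + ∣ S ∣ + ∣ S ∣          ∎)
      in ⊕⊖≡𝟘⇒≡ w w′ (independent (T ∪ T′) (⊆-trans S⊆T (p⊆p∪q T′))
           (λ i∈ → Sum.[ T⊆B , T′⊆B ] (x∈p∪q⁻ T T′ i∈)) ∪≤ (w ⊕ ⊖ w′)
           (supported-⊖ w w′ (supported-mono w (p⊆p∪q T′) s) (supported-mono w′ (q⊆p∪q T T′) s′))
           (trans (comb-⊖ w w′ vs) (trans (cong (_⊕ ⊖ comb w′ vs) eq) (⊕-inverseʳ _))))

  -- Counting

  ∑ : List X → (X → ℕ) → ℕ
  ∑ []       f = 0
  ∑ (x ∷ xs) f = f x + ∑ xs f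

  -- The Iverson bracket. Matching on the boolean alone lets it compute on compound decisions built
  -- with `×-dec` and `¬?`.
  ⟦_⟧ : {P : Set} → Dec P → ℕ
  ⟦ true because _ ⟧  = 1
  ⟦ false because _ ⟧ = 0

  ∑-cong : (xs : List X) {f g : X → ℕ} → (∀ x → f x ≡ g x) → ∑ xs f ≡ ∑ xs g
  ∑-cong []       eq = refl
  ∑-cong (x ∷ xs) eq = cong₂ _+_ (eq x) (∑-cong xs eq)

  ∑-mono : (xs : List X) {f g : X → ℕ} → (∀ x → f x ≤ g x) → ∑ xs f ≤ ∑ xs g
  ∑-mono []       le = z≤n
  ∑-mono (x ∷ xs) le = +-mono-≤ (le x) (∑-mono xs le)

  ∑-*ˡ : (xs : List X) (c : ℕ) (f : X → ℕ) → ∑ xs (λ x → c * f x) ≡ c * ∑ xs f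
  ∑-*ˡ []       c f = sym (*-zeroʳ c)
  ∑-*ˡ (x ∷ xs) c f = trans (cong (c * f x +_) (∑-*ˡ xs c f)) (sym (*-distribˡ-+ c (f x) _))

  ∑-*ʳ : (xs : List X) (c : ℕ) (f : X → ℕ) → ∑ xs (λ x → f x * c) ≡ ∑ xs f * c
  ∑-*ʳ xs c f = trans (∑-cong xs λ x → *-comm (f x) c) (trans (∑-*ˡ xs c f) (*-comm c _))

  ∑-const : (xs : List X) (c : ℕ) → ∑ xs (λ _ → c) ≡ length xs * c
  ∑-const []       c = refl
  ∑-const (x ∷ xs) c = cong (c +_) (∑-const xs c)

  ∑-+ : (xs : List X) (f g : X → ℕ) → ∑ xs (λ x → f x + g x) ≡ ∑ xs f + ∑ xs g
  ∑-+ []       f g = refl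
  ∑-+ (x ∷ xs) f g = trans (cong (f x + g x +_) (∑-+ xs f g))
    (solve 4 (λ a b c d → (a :+ b) :+ (c :+ d) := (a :+ c) :+ (b :+ d)) refl (f x) (g x) _ _)

  ∑-swap : (xs : List X) (ys : List Y) (f : X → Y → ℕ) →
           ∑ xs (λ x → ∑ ys (f x)) ≡ ∑ ys (λ y → ∑ xs (λ x → f x y))
  ∑-swap []       ys f = sym (trans (∑-const ys 0) (*-zeroʳ (length ys)))
  ∑-swap (x ∷ xs) ys f = trans (cong (∑ ys (f x) +_) (∑-swap xs ys f))
    (sym (∑-+ ys (f x) (λ y → ∑ xs (λ x → f x y))))

  ∑-++ : (xs ys : List X) (f : X → ℕ) → ∑ (xs ++ ys) f ≡ ∑ xs f + ∑ ys f
  ∑-++ []       ys f = refl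
  ∑-++ (x ∷ xs) ys f = trans (cong (f x +_) (∑-++ xs ys f)) (sym (+-assoc (f x) _ _))

  ∑-map : (g : X → Y) (xs : List X) (f : Y → ℕ) → ∑ (map g xs) f ≡ ∑ xs (f ∘ g)
  ∑-map g []       f = refl
  ∑-map g (x ∷ xs) f = cong (f (g x) +_) (∑-map g xs f)

  ∑-cartesianProductWith : (g : X → Y → Z) (xs : List X) (ys : List Y) (f : Z → ℕ) →
    ∑ (cartesianProductWith g xs ys) f ≡ ∑ xs (λ x → ∑ ys (λ y → f (g x y)))
  ∑-cartesianProductWith g []       ys f = refl
  ∑-cartesianProductWith g (x ∷ xs) ys f = trans (∑-++ (map (g x) ys) _ f)
    (cong₂ _+_ (∑-map (g x) ys f) (∑-cartesianProductWith g xs ys f))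

  -- First-moment principle: if `g` were below `f` throughout a non-empty list, the sums would be
  -- strictly ordered as well.
  ∑≤∑⇒∃≤ : (xs : List X) (f g : X → ℕ) → 0 < length xs → ∑ xs f ≤ ∑ xs g → ∃[ x ] f x ≤ g x
  ∑≤∑⇒∃≤ (x ∷ xs) f g _ le with f x ≤? g x
  ... | yes fx≤gx = x , fx≤gx
  ∑≤∑⇒∃≤ (x ∷ []) f g _ le | no fx≰gx =
    contradiction (subst₂ _≤_ (+-identityʳ _) (+-identityʳ _) le) fx≰gx
  ∑≤∑⇒∃≤ (x ∷ xs@(_ ∷ _)) f g _ le | no fx≰gx = ∑≤∑⇒∃≤ xs f g z<s
    (≮⇒≥ λ lt → <⇒≱ (+-mono-< (≰⇒> fx≰gx) lt) le)

  ⟦×⟧ : {P Q : Set} (p : Dec P) (q : Dec Q) → ⟦ p ×-dec q ⟧ ≡ ⟦ p ⟧ * ⟦ q ⟧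
  ⟦×⟧ (true because _)  (true because _)  = refl
  ⟦×⟧ (true because _)  (false because _) = refl
  ⟦×⟧ (false because _) _                 = refl

  ⟦P⟧+⟦¬P⟧ : {P : Set} (p : Dec P) → ⟦ p ⟧ + ⟦ ¬? p ⟧ ≡ 1
  ⟦P⟧+⟦¬P⟧ (true because _)  = refl
  ⟦P⟧+⟦¬P⟧ (false because _) = refl

  length-filter : {P : X → Set} (P? : Decidable P) (xs : List X) →
                  length (filter P? xs) ≡ ∑ xs (λ x → ⟦ P? x ⟧)
  length-filter P? []       = refl
  length-filter P? (x ∷ xs) with P? x
  ... | true because _  = cong suc (length-filter P? xs)
  ... | false because _ = length-filter P? xs

  -- The entries of `xs` inside `L` inject into `L`, so at most `length L` of them are lost, even if
  -- `L` repeats vectors.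
  fresh-count : {xs : List (𝔽₃^ r)} → Unique xs → (L : List (𝔽₃^ r)) →
                length xs ≤ length L + ∑ xs (λ v → ⟦ ¬? (v ∈? L) ⟧)
  fresh-count {xs = xs} u L = begin
    length xs                                        ≡⟨ *-identityʳ _ ⟨
    length xs * 1                                    ≡⟨ ∑-const xs 1 ⟨
    ∑ xs (λ _ → 1)
      ≡⟨ ∑-cong xs (λ v → sym (⟦P⟧+⟦¬P⟧ (v ∈? L))) ⟩
    ∑ xs (λ v → ⟦ v ∈? L ⟧ + ⟦ ¬? (v ∈? L) ⟧)        ≡⟨ ∑-+ xs _ _ ⟩
    ∑ xs (λ v → ⟦ v ∈? L ⟧) + ∑ xs (λ v → ⟦ ¬? (v ∈? L) ⟧)
      ≡⟨ cong (_+ ∑ xs (λ v → ⟦ ¬? (v ∈? L) ⟧)) (length-filter (_∈? L) xs) ⟨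
    length (filter (_∈? L) xs) + ∑ xs (λ v → ⟦ ¬? (v ∈? L) ⟧)
      ≤⟨ +-monoˡ-≤ _ (injectiveOn⇒length≤ id (Unique.filter⁺ (_∈? L) u) (λ _ _ → id)
           (λ v∈ → proj₂ (∈-filter⁻ (_∈? L) {xs = xs} v∈))) ⟩
    length L + ∑ xs (λ v → ⟦ ¬? (v ∈? L) ⟧)  ∎
    where open ≤-Reasoning

  -- The density of bases

  -- basisNum k / basisDen k = (1 - 3⁻¹)(1 - 3⁻²)⋯(1 - 3⁻ᵏ), the probability that
  -- k random vectors form a basis of 𝔽₃ᵏ.
  basisNum basisDen : ℕ → ℕ
  basisNum zero    = 1
  basisNum (suc k) = pred (3 ^ suc k) * basisNum k
  basisDen zero    = 1
  basisDen (suc k) = 3 ^ suc k * basisDen k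

  basisDen≢0 : ∀ k → NonZero (basisDen k)
  basisDen≢0 zero    = _
  basisDen≢0 (suc k) = m*n≢0 (3 ^ suc k) (basisDen k) {{m^n≢0 3 (suc k)}} {{basisDen≢0 k}}

  -- The ratio is at least (14/25)(1 + (27/53)3⁻ᵏ) for k ≥ 3; this bound, unlike
  -- the plain one, is inductive.
  density-strong : ∀ k → let t = 3 ^ (3 + k) in
    14 * (53 * t + 27) * basisDen (3 + k) ≤ 25 * 53 * t * basisNum (3 + k)
  density-strong zero    = from-yes (14 * (53 * 27 + 27) * basisDen 3 ≤? 25 * 53 * 27 * basisNum 3)
  -- Writing `3 ^ (3 + k)` as `27 + u` gives a polynomial inequality in which `pred` computes.
  density-strong (suc k) = subst
      (λ t → 14 * (53 * t + 27) * basisDen (3 + k) ≤ 25 * 53 * t * basisNum (3 + k) →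
        14 * (53 * (3 * t) + 27) * (3 * t * basisDen (3 + k)) ≤
        25 * 53 * (3 * t) * (pred (3 * t) * basisNum (3 + k)))
      (m+[n∸m]≡n 27≤3^)
      (step (3 ^ (3 + k) ∸ 27) (basisDen (3 + k)) (basisNum (3 + k)))
      (density-strong k)
    where
    27≤3^ : 27 ≤ 3 ^ (3 + k)
    27≤3^ = ^-monoʳ-≤ 3 (m≤m+n 3 k)
    step : ∀ u d m → let t = 27 + u in 14 * (53 * t + 27) * d ≤ 25 * 53 * t * m →
      14 * (53 * (3 * t) + 27) * (3 * t * d) ≤ 25 * 53 * (3 * t) * (pred (3 * t) * m)
    step u d m le = begin
      14 * (53 * (3 * t) + 27) * (3 * t * d)
        -- For a surplus factor 1 + c/t, passing from t to 3t requires c ≥ t/(2t - 1). This bound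
        -- decreases in t and equals 27/53 at t = 27, so the slack added here is a multiple of `u`,
        -- that is t - 27.
        ≤⟨ m≤m+n _ _ ⟩
      14 * (53 * (3 * t) + 27) * (3 * t * d) + u * (14 * 3 * d)
        ≡⟨ solve 2 (λ u d → let t = con 27 :+ u in
             con 14 :* (con 53 :* (con 3 :* t) :+ con 27) :* (con 3 :* t :* d) :+
               u :* (con 14 :* con 3 :* d) :=
             con 3 :* (con 80 :+ con 3 :* u) :* (con 14 :* (con 53 :* t :+ con 27) :* d)) refl u d ⟩
      3 * (80 + 3 * u) * (14 * (53 * t + 27) * d)
        ≤⟨ *-monoʳ-≤ (3 * (80 + 3 * u)) le ⟩
      3 * (80 + 3 * u) * (25 * 53 * t * m)
        ≡⟨ solve 3 (λ q t m → con 3 :* q :* (con 1325 :* t :* m) := con 1325 :* (con 3 :* t) :* (q :* m))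
             refl (80 + 3 * u) t m ⟩
      25 * 53 * (3 * t) * ((80 + 3 * u) * m)
        ≡⟨ cong (λ q → 25 * 53 * (3 * t) * (pred q * m))
             (solve 1 (λ u → con 81 :+ con 3 :* u := con 3 :* (con 27 :+ u)) refl u) ⟩
      25 * 53 * (3 * t) * (pred (3 * t) * m) ∎
      where
      open ≤-Reasoning
      t = 27 + u

  density : ∀ k → 14 * basisDen k ≤ 25 * basisNum k
  density 0 = from-yes (14 ≤? 25)
  density 1 = from-yes (14 * basisDen 1 ≤? 25 * basisNum 1)
  density 2 = from-yes (14 * basisDen 2 ≤? 25 * basisNum 2)
  density (suc (suc (suc k))) = *-cancelˡ-≤ (53 * t) {{m*n≢0 53 t {{_}} {{m^n≢0 3 (3 + k)}}}} (begin
    53 * t * (14 * d)        ≤⟨ m≤m+n _ (14 * 27 * d) ⟩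
    53 * t * (14 * d) + 14 * 27 * d
      ≡⟨ solve 2 (λ t d → con 53 :* t :* (con 14 :* d) :+ con 378 :* d :=
           con 14 :* (con 53 :* t :+ con 27) :* d) refl t d ⟩
    14 * (53 * t + 27) * d   ≤⟨ density-strong k ⟩
    25 * 53 * t * m
      ≡⟨ solve 2 (λ t m → con 1325 :* t :* m := con 53 :* t :* (con 25 :* m)) refl t m ⟩
    53 * t * (25 * m)        ∎)
    where
    open ≤-Reasoning
    t = 3 ^ (3 + k)
    d = basisDen (3 + k)
    m = basisNum (3 + k)

  -- Averaging over families of vectors

  space : ∀ r → List (𝔽₃^ r)
  space = vectors (allFin 3)

  length-space : ∀ r → length (space r) ≡ 3 ^ r
  length-space = length-vectors (allFin 3)

  length-families : ∀ r n → length (vectors (space r) n) ≡ (3 ^ r) ^ n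
  length-families r n = trans (length-vectors (space r) n) (cong (_^ n) (length-space r))

  extensions : List (𝔽₃^ r) → Subset n → ℕ
  extensions {r} {n} L A = ∑ (vectors (space r) n) (λ vs → ⟦ extends? L vs A ⟧)

  length-adjoin : (v : 𝔽₃^ r) (L : List (𝔽₃^ r)) → length (adjoin v L) ≡ 3 * length L
  length-adjoin v L = trans (length-++ L) (cong (length L +_) (trans (length-++ (map (v ⊕_) L))
    (cong₂ _+_ (length-map (v ⊕_) L)
      (trans (length-map (⊖ v ⊕_) L) (sym (+-identityʳ _))))))

  extensions-inside : (L : List (𝔽₃^ r)) (A : Subset n) → extensions L (inside ∷ A) ≡
    ∑ (space r) (λ v → ⟦ ¬? (v ∈? L) ⟧ * extensions (adjoin v L) A)
  extensions-inside {r} {n} L A = trans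
    (∑-cartesianProductWith _∷_ (space r) (vectors (space r) n) (λ vs → ⟦ extends? L vs (inside ∷ A) ⟧))
    (∑-cong (space r) λ v →
      trans (∑-cong (vectors (space r) n) λ vs → ⟦×⟧ (¬? (v ∈? L)) (extends? (adjoin v L) vs A))
        (∑-*ˡ (vectors (space r) n) ⟦ ¬? (v ∈? L) ⟧ _))

  extensions-outside : (L : List (𝔽₃^ r)) (A : Subset n) →
    extensions L (outside ∷ A) ≡ 3 ^ r * extensions L A
  extensions-outside {r} {n} L A = trans
    (∑-cartesianProductWith _∷_ (space r) (vectors (space r) n) (λ vs → ⟦ extends? L vs (outside ∷ A) ⟧))
    (trans (∑-const (space r) (extensions L A)) (cong (_* extensions L A) (length-space r)))

  -- The hypothesis gives `L` the length of a subspace of codimension `∣ A ∣`. The first selected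
  -- vector must avoid `L`, which leaves at least a fraction 1 - 1/3^∣A∣ of the space, and adjoining
  -- it lowers the codimension by one. Vectors that are not selected are free.
  extensions-bound : (L : List (𝔽₃^ r)) (A : Subset n) → 3 ^ r ≡ 3 ^ ∣ A ∣ * length L →
    basisNum ∣ A ∣ * (3 ^ r) ^ n ≤ basisDen ∣ A ∣ * extensions L A
  extensions-bound L [] _ = ≤-refl
  extensions-bound {r} {suc n} L (outside ∷ A) eq = begin
    m * (N * N ^ n)             ≡⟨ *-exchange m N (N ^ n) ⟩
    N * (m * N ^ n)             ≤⟨ *-monoʳ-≤ N (extensions-bound L A eq) ⟩
    N * (d * extensions L A)    ≡⟨ *-exchange N d (extensions L A) ⟩
    d * (N * extensions L A)    ≡⟨ cong (d *_) (extensions-outside L A) ⟨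
    d * extensions L (outside ∷ A) ∎
    where
    open ≤-Reasoning
    N = 3 ^ r
    m = basisNum ∣ A ∣
    d = basisDen ∣ A ∣
  extensions-bound {r} {suc n} L (inside ∷ A) eq = begin
    pred q * m * (N * N ^ n)
      ≡⟨ solve 4 (λ p m a b → p :* m :* (a :* b) := p :* a :* (m :* b)) refl (pred q) m N (N ^ n) ⟩
    pred q * N * (m * N ^ n)
      ≡⟨ cong (λ x → pred q * x * (m * N ^ n)) eq ⟩
    pred q * (q * ℓ) * (m * N ^ n)
      ≡⟨ solve 4 (λ p q l x → p :* (q :* l) :* x := q :* ((p :* l) :* x)) refl (pred q) q ℓ (m * N ^ n) ⟩
    q * (pred q * ℓ * (m * N ^ n))
      ≤⟨ *-monoʳ-≤ q (*-monoˡ-≤ (m * N ^ n) fresh≥) ⟩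
    q * (∑ (space r) fresh * (m * N ^ n))
      ≡⟨ cong (q *_) (∑-*ʳ (space r) (m * N ^ n) fresh) ⟨
    q * ∑ (space r) (λ v → fresh v * (m * N ^ n))
      ≤⟨ *-monoʳ-≤ q (∑-mono (space r) λ v → *-monoʳ-≤ (fresh v) (extensions-bound (adjoin v L) A (eq′ v))) ⟩
    q * ∑ (space r) (λ v → fresh v * (d * extensions (adjoin v L) A))
      ≡⟨ cong (q *_) (∑-cong (space r) λ v → *-exchange (fresh v) d (extensions (adjoin v L) A)) ⟩
    q * ∑ (space r) (λ v → d * (fresh v * extensions (adjoin v L) A))
      ≡⟨ cong (q *_) (∑-*ˡ (space r) d _) ⟩
    q * (d * ∑ (space r) (λ v → fresh v * extensions (adjoin v L) A))
      ≡⟨ *-assoc q d _ ⟨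
    q * d * ∑ (space r) (λ v → fresh v * extensions (adjoin v L) A)
      ≡⟨ cong (q * d *_) (extensions-inside L A) ⟨
    q * d * extensions L (inside ∷ A) ∎
    where
    open ≤-Reasoning
    N = 3 ^ r
    q = 3 ^ suc ∣ A ∣
    ℓ = length L
    m = basisNum ∣ A ∣
    d = basisDen ∣ A ∣
    fresh : 𝔽₃^ r → ℕ
    fresh v = ⟦ ¬? (v ∈? L) ⟧
    eq′ : ∀ v → N ≡ 3 ^ ∣ A ∣ * length (adjoin v L)
    eq′ v = trans eq (trans
      (solve 2 (λ a l → con 3 :* a :* l := a :* (con 3 :* l)) refl (3 ^ ∣ A ∣) ℓ)
      (cong (3 ^ ∣ A ∣ *_) (sym (length-adjoin v L))))
    fresh≥ : pred q * ℓ ≤ ∑ (space r) fresh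
    fresh≥ = +-cancelˡ-≤ ℓ _ _ (begin
      ℓ + pred q * ℓ                 ≡⟨ cong (_* ℓ) (suc-pred q {{m^n≢0 3 (suc ∣ A ∣)}}) ⟩
      q * ℓ                          ≡⟨ eq ⟨
      N                              ≡⟨ length-space r ⟨
      length (space r)               ≤⟨ fresh-count (vectors-unique (Unique.allFin⁺ 3) r) L ⟩
      ℓ + ∑ (space r) fresh          ∎)

  -- `r` independent vectors of 𝔽₃ʳ form a basis, so the name fits when `∣ A ∣` is `r`, the case
  -- that is counted.
  Basis : Vec (𝔽₃^ r) n → Subset n → Set
  Basis = Extends [ 𝟘 ]

  basis? : (vs : Vec (𝔽₃^ r) n) (A : Subset n) → Dec (Basis vs A)
  basis? = extends? [ 𝟘 ]

  layerBases : Vec (𝔽₃^ r) n → ℕ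
  layerBases {r} {n} vs = ∑ (subsets n) (λ A → ⟦ ∣ A ∣ ≟ r ⟧ * ⟦ basis? vs A ⟧)

  -- The comparison is required only where the bracket is 1, so `extensions-bound` can be applied to
  -- one layer within a sum over all subsets.
  ⟦≡⟧*-mono : ∀ {i j : X} {a b} (p : Dec (i ≡ j)) → (i ≡ j → a ≤ b) → ⟦ p ⟧ * a ≤ ⟦ p ⟧ * b
  ⟦≡⟧*-mono (yes eq) le = +-monoˡ-≤ 0 (le eq)
  ⟦≡⟧*-mono (no _)   _  = z≤n

  -- Double counting of pairs of a family and an `r`-set: each `r`-set is a basis for at least the
  -- fraction `basisNum r / basisDen r`, hence 14/25, of all families, so some family attains this
  -- share of the layer.
  good-family : ∀ n r → ∃[ vs ] 14 * ∑ (subsets n) (λ A → ⟦ ∣ A ∣ ≟ r ⟧) ≤ 25 * layerBases {r} {n} vs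
  good-family n r = ∑≤∑⇒∃≤ families (λ _ → 14 * C) (λ vs → 25 * layerBases vs)
    (subst (0 <_) (sym (length-families r n))
      (m^n>0 (3 ^ r) {{m^n≢0 3 r}} n))
    (*-cancelˡ-≤ d {{basisDen≢0 r}} (begin
      d * ∑ families (λ _ → 14 * C)        ≡⟨ cong (d *_) (∑-const families (14 * C)) ⟩
      d * (length families * (14 * C))     ≡⟨ cong (λ W → d * (W * (14 * C))) (length-families r n) ⟩
      d * (W * (14 * C))                   ≡⟨ solve 3 (λ d W C → d :* (W :* (con 14 :* C)) :=
                                                (con 14 :* d) :* (C :* W)) refl d W C ⟩
      14 * d * (C * W)                     ≤⟨ *-monoˡ-≤ (C * W) (density r) ⟩
      25 * m * (C * W)                     ≡⟨ solve 3 (λ m W C → con 25 :* m :* (C :* W) :=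
                                                con 25 :* (C :* (m :* W))) refl m W C ⟩
      25 * (C * (m * W))                   ≡⟨ cong (25 *_) (∑-*ʳ (subsets n) (m * W) _) ⟨
      25 * ∑ (subsets n) (λ A → ⟦ ∣ A ∣ ≟ r ⟧ * (m * W))
        ≤⟨ *-monoʳ-≤ 25 (∑-mono (subsets n) λ A → ⟦≡⟧*-mono (∣ A ∣ ≟ r) (bound A)) ⟩
      25 * ∑ (subsets n) (λ A → ⟦ ∣ A ∣ ≟ r ⟧ * (d * extensions [ 𝟘 ] A))
        ≡⟨ cong (25 *_) (∑-cong (subsets n) λ A → *-exchange ⟦ ∣ A ∣ ≟ r ⟧ d (extensions [ 𝟘 ] A)) ⟩
      25 * ∑ (subsets n) (λ A → d * (⟦ ∣ A ∣ ≟ r ⟧ * extensions [ 𝟘 ] A))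
        ≡⟨ cong (25 *_) (∑-*ˡ (subsets n) d _) ⟩
      25 * (d * ∑ (subsets n) (λ A → ⟦ ∣ A ∣ ≟ r ⟧ * extensions [ 𝟘 ] A))
        ≡⟨ *-exchange 25 d _ ⟩
      d * (25 * ∑ (subsets n) (λ A → ⟦ ∣ A ∣ ≟ r ⟧ * extensions [ 𝟘 ] A))
        ≡⟨ cong (λ x → d * (25 * x)) (∑-cong (subsets n) λ A → ∑-*ˡ families ⟦ ∣ A ∣ ≟ r ⟧ _) ⟨
      d * (25 * ∑ (subsets n) (λ A → ∑ families (λ vs → ⟦ ∣ A ∣ ≟ r ⟧ * ⟦ basis? vs A ⟧)))
        ≡⟨ cong (λ x → d * (25 * x)) (∑-swap (subsets n) families _) ⟩
      d * (25 * ∑ families layerBases)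
        ≡⟨ cong (d *_) (∑-*ˡ families 25 layerBases) ⟨
      d * ∑ families (λ vs → 25 * layerBases vs) ∎))
    where
    open ≤-Reasoning
    families = vectors (space r) n
    C = ∑ (subsets n) (λ A → ⟦ ∣ A ∣ ≟ r ⟧)
    W = (3 ^ r) ^ n
    m = basisNum r
    d = basisDen r
    bound : ∀ A → ∣ A ∣ ≡ r → m * W ≤ d * extensions {r} [ 𝟘 ] A
    -- The zero subspace has one element, so its codimension condition is `3 ^ r` = `3 ^ ∣ A ∣ * 1`.
    bound A refl = extensions-bound [ 𝟘 ] A (sym (*-identityʳ _))

  -- The mutual-visibility set

  ∑-downFrom-select : ∀ m k (h : ℕ → ℕ) → k < m → ∑ (downFrom m) (λ r → ⟦ k ≟ r ⟧ * h r) ≡ h k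
  ∑-downFrom-select (suc m) k h k<1+m with k ≟ m
  ... | yes refl = trans (cong₂ _+_ (+-identityʳ (h k)) (vanish k ≤-refl)) (+-identityʳ (h k))
    where
    vanish : ∀ m → m ≤ k → ∑ (downFrom m) (λ r → ⟦ k ≟ r ⟧ * h r) ≡ 0
    vanish zero    _   = refl
    vanish (suc m) m<k with k ≟ m
    ... | yes refl = contradiction m<k 1+n≰n
    ... | no  _    = vanish m (<⇒≤ m<k)
  ... | no k≢m = ∑-downFrom-select m k h (≤∧≢⇒< (s≤s⁻¹ k<1+m) k≢m)

  ∑-by-fibre : ∀ m (xs : List X) (key : X → ℕ) → (∀ x → key x < m) → (h : ℕ → X → ℕ) →
    ∑ (downFrom m) (λ r → ∑ xs (λ x → ⟦ key x ≟ r ⟧ * h r x)) ≡ ∑ xs (λ x → h (key x) x)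
  ∑-by-fibre m xs key key< h = trans (∑-swap (downFrom m) xs _)
    (∑-cong xs λ x → ∑-downFrom-select m (key x) (λ r → h r x) (key< x))

  length-subsets : ∀ n → length (subsets n) ≡ 2 ^ n
  length-subsets zero    = refl
  length-subsets (suc n) = trans (length-++ (map (outside ∷_) (subsets n)))
    (cong₂ _+_ (trans (length-map _ (subsets n)) (length-subsets n))
      (trans (trans (length-map _ (subsets n)) (length-subsets n)) (sym (+-identityʳ _))))

  subsets-unique : ∀ n → Unique (subsets n)
  subsets-unique zero    = [] ∷ []
  subsets-unique (suc n) = Unique.++⁺ (Unique.map⁺ ∷-injectiveʳ (subsets-unique n))
    (Unique.map⁺ ∷-injectiveʳ (subsets-unique n)) λ (∈out , ∈in) → disjoint ∈out ∈in
    where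
    disjoint : ∀ {A} → A ∈ˡ map (outside ∷_) (subsets n) → A ∉ map (inside ∷_) (subsets n)
    disjoint ∈out ∈in with _ , _ , refl ← ∈-map⁻ (outside ∷_) ∈out
      with ∈-map⁻ (inside ∷_) ∈in
    ... | _ , _ , ()

  abstract
    -- Kept abstract so that the search over all families is never unfolded.
    family : ∀ n r → Vec (𝔽₃^ r) n
    family n r = proj₁ (good-family n r)

    family-bound : ∀ n r → 14 * ∑ (subsets n) (λ A → ⟦ ∣ A ∣ ≟ r ⟧) ≤ 25 * layerBases (family n r)
    family-bound n r = proj₂ (good-family n r)

  -- Each layer has a family of its own, in dimension `∣ A ∣`.
  IsChosen : Fin 3 → Subset n → Set
  IsChosen {n} a A = residue ∣ A ∣ ≡ a × Basis (family n ∣ A ∣) A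

  isChosen? : (a : Fin 3) (A : Subset n) → Dec (IsChosen a A)
  isChosen? {n} a A = (residue ∣ A ∣ Fin.≟ a) ×-dec basis? (family n ∣ A ∣) A

  chosen : ∀ n → Fin 3 → List (Subset n)
  chosen n a = filter (isChosen? a) (subsets n)

  -- `no-five-arc` only refutes that every candidate `T` is chosen; decidability of the search over
  -- subsets turns this into a witness. All candidates have size `2 + ∣ C ∣` and hence share one
  -- family.
  detour : ∀ a (C B : Subset n) → C ⊆ B → 5 + ∣ C ∣ ≤ ∣ B ∣ →
           ∃[ T ] C ⊆ T × T ⊆ B × ∣ T ∣ ≡ 2 + ∣ C ∣ × ¬ IsChosen a T
  detour {n} a C B C⊆B le = decidable-stable
    (anySubset? λ T → C ⊆? T ×-dec T ⊆? B ×-dec ∣ T ∣ ≟ 2 + ∣ C ∣ ×-dec ¬? (isChosen? a T))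
    λ none → no-five-arc C B (family n (2 + ∣ C ∣)) C⊆B le
      λ T C⊆T T⊆B eq → independent T eq (proj₂ (decidable-stable (isChosen? a T)
        λ ¬chosen → none (T , C⊆T , T⊆B , eq , ¬chosen)))
    where
    independent : ∀ {r} T → ∣ T ∣ ≡ r → Basis (family n ∣ T ∣) T → Independent (family n r) T
    independent T refl = extends⇒independent (family n ∣ T ∣) T

  mapʷ : ∀ {P R : Subset n → Set} {A B k} → (∀ {C} → P C → R C) → Walk P A B k → Walk R A B k
  mapʷ f (stay p)      = stay (f p)
  mapʷ f (p ∷⟨ e ⟩ w) = f p ∷⟨ e ⟩ mapʷ f w

  chosen-mutuallyVisible : ∀ n a → IsMutualVisibilitySet (Q n) (chosen n a)
  chosen-mutuallyVisible n a = mkIsMutualVisibilitySet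
    (Unique.filter⁺ (isChosen? a) (subsets-unique n)) visible
    where
    open Routing (IsChosen {n} a) a (λ _ → proj₁) (detour a)
    isChosen : ∀ {A} → A ∈ˡ chosen n a → IsChosen a A
    isChosen A∈ = proj₂ (∈-filter⁻ (isChosen? a) {xs = subsets n} A∈)
    visible : ∀ A B → A ∈ˡ chosen n a → B ∈ˡ chosen n a → Visible (Q n) (chosen n a) A B
    visible A B A∈ B∈ with ≤-total ∣ A ∣ ∣ B ∣
    ... | inj₁ ∣A∣≤∣B∣ = geodesic⇒visible
      (mapʷ (λ clear (C∈ , C≢A , C≢B) → clear (isChosen C∈ , C≢A , C≢B))
        (route (isChosen A∈) (isChosen B∈) ∣A∣≤∣B∣))
    -- `route` starts from the smaller set, so the walk is built from `B` to `A` and then reversed.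
    ... | inj₂ ∣B∣≤∣A∣ = geodesic⇒visible (subst (Walk _ A B) (△-sym B A)
      (reverseʷ (mapʷ (λ clear (C∈ , C≢A , C≢B) → clear (isChosen C∈ , C≢B , C≢A))
        (route (isChosen B∈) (isChosen A∈) ∣B∣≤∣A∣))))

  -- The bounds `family-bound` are added over the layers 0 to `n`, which exhaust the subsets.
  bases-count : ∀ n → 14 * 2 ^ n ≤ 25 * ∑ (subsets n) (λ A → ⟦ basis? (family n ∣ A ∣) A ⟧)
  bases-count n = begin
    14 * 2 ^ n                         ≡⟨ cong (14 *_) (length-subsets n) ⟨
    14 * length (subsets n)            ≡⟨ cong (14 *_) (trans (∑-const (subsets n) 1) (*-identityʳ (length (subsets n)))) ⟨
    14 * ∑ (subsets n) (λ _ → 1)       ≡⟨ cong (14 *_) (by-layer (λ _ _ → 1)) ⟨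
    14 * ∑ (downFrom (suc n)) (λ r → ∑ (subsets n) (λ A → ⟦ ∣ A ∣ ≟ r ⟧ * 1))
      ≡⟨ cong (14 *_) (∑-cong (downFrom (suc n)) λ r → ∑-cong (subsets n) λ A → *-identityʳ ⟦ ∣ A ∣ ≟ r ⟧) ⟩
    14 * ∑ (downFrom (suc n)) (λ r → ∑ (subsets n) (λ A → ⟦ ∣ A ∣ ≟ r ⟧))
      ≡⟨ ∑-*ˡ (downFrom (suc n)) 14 (λ r → ∑ (subsets n) (λ A → ⟦ ∣ A ∣ ≟ r ⟧)) ⟨
    ∑ (downFrom (suc n)) (λ r → 14 * ∑ (subsets n) (λ A → ⟦ ∣ A ∣ ≟ r ⟧))
      ≤⟨ ∑-mono (downFrom (suc n)) (family-bound n) ⟩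
    ∑ (downFrom (suc n)) (λ r → 25 * layerBases (family n r))
      ≡⟨ ∑-*ˡ (downFrom (suc n)) 25 (λ r → layerBases (family n r)) ⟩
    25 * ∑ (downFrom (suc n)) (λ r → layerBases (family n r))
      ≡⟨ cong (25 *_) (by-layer (λ r A → ⟦ basis? (family n r) A ⟧)) ⟩
    25 * ∑ (subsets n) (λ A → ⟦ basis? (family n ∣ A ∣) A ⟧) ∎
    where
    open ≤-Reasoning
    by-layer : (h : ℕ → Subset n → ℕ) →
      ∑ (downFrom (suc n)) (λ r → ∑ (subsets n) (λ A → ⟦ ∣ A ∣ ≟ r ⟧ * h r A)) ≡
      ∑ (subsets n) (λ A → h ∣ A ∣ A)
    by-layer = ∑-by-fibre (suc n) (subsets n) ∣_∣ (λ A → s≤s (∣p∣≤n A))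

  chosen-partition : ∀ n → ∑ (allFin 3) (λ a → length (chosen n a)) ≡
                     ∑ (subsets n) (λ A → ⟦ basis? (family n ∣ A ∣) A ⟧)
  chosen-partition n = begin
    ∑ (allFin 3) (λ a → length (chosen n a))
      ≡⟨ ∑-cong (allFin 3) (λ a → trans (length-filter (isChosen? a) (subsets n))
           (∑-cong (subsets n) λ A → ⟦×⟧ (residue ∣ A ∣ Fin.≟ a) (basis? (family n ∣ A ∣) A))) ⟩
    ∑ (allFin 3) (λ a → ∑ (subsets n) (λ A → ⟦ residue ∣ A ∣ Fin.≟ a ⟧ * b A))
      ≡⟨ ∑-swap (allFin 3) (subsets n) (λ a A → ⟦ residue ∣ A ∣ Fin.≟ a ⟧ * b A) ⟩
    ∑ (subsets n) (λ A → ∑ (allFin 3) (λ a → ⟦ residue ∣ A ∣ Fin.≟ a ⟧ * b A))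
      ≡⟨ ∑-cong (subsets n) (λ A → trans (∑-*ʳ (allFin 3) (b A) (λ a → ⟦ residue ∣ A ∣ Fin.≟ a ⟧))
           (trans (cong (_* b A) (once (residue ∣ A ∣))) (*-identityˡ (b A)))) ⟩
    ∑ (subsets n) b ∎
    where
    open ≡-Reasoning
    b : Subset n → ℕ
    b A = ⟦ basis? (family n ∣ A ∣) A ⟧
    once : ∀ x → ∑ (allFin 3) (λ a → ⟦ x Fin.≟ a ⟧) ≡ 1
    once zero             = refl
    once (suc zero)       = refl
    once (suc (suc zero)) = refl

  abstract
    3-prime : Prime 3
    3-prime = from-yes (prime? 3)

  3∤2^n : ∀ n → ¬ 3 ∣ 2 ^ n
  3∤2^n zero    3∣ = from-no (3 ∣? 1) 3∣
  3∤2^n (suc n) 3∣ = Sum.[ from-no (3 ∣? 2) , 3∤2^n n ]′ (euclidsLemma 2 (2 ^ n) 3-prime 3∣)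

  large-chosen : ∀ n → ∃[ a ] 14 * 2 ^ n < 75 * length (chosen n a)
  large-chosen n =
    let a , le = ∑≤∑⇒∃≤ (allFin 3) (λ _ → 14 * 2 ^ n) (λ a → 75 * length (chosen n a)) z<s average
    in a , ≤∧≢⇒< le (14*2^n≢75* (length (chosen n a)))
    where
    open ≤-Reasoning
    b = ∑ (subsets n) (λ A → ⟦ basis? (family n ∣ A ∣) A ⟧)
    average : ∑ (allFin 3) (λ _ → 14 * 2 ^ n) ≤ ∑ (allFin 3) (λ a → 75 * length (chosen n a))
    average = begin
      ∑ (allFin 3) (λ _ → 14 * 2 ^ n)                ≡⟨ ∑-const (allFin 3) (14 * 2 ^ n) ⟩
      3 * (14 * 2 ^ n)                               ≤⟨ *-monoʳ-≤ 3 (bases-count n) ⟩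
      3 * (25 * b)                                   ≡⟨ *-assoc 3 25 b ⟨
      75 * b                                         ≡⟨ cong (75 *_) (chosen-partition n) ⟨
      75 * ∑ (allFin 3) (λ a → length (chosen n a))  ≡⟨ ∑-*ˡ (allFin 3) 75 (λ a → length (chosen n a)) ⟨
      ∑ (allFin 3) (λ a → 75 * length (chosen n a))  ∎
    -- Equality would make 3, a divisor of 75, divide `14 * 2 ^ n`.
    14*2^n≢75* : ∀ m → 14 * 2 ^ n ≢ 75 * m
    14*2^n≢75* m eq = Sum.[ from-no (3 ∣? 14) , 3∤2^n n ]′ (euclidsLemma 14 (2 ^ n) 3-prime
      (divides (25 * m) (trans eq (trans (*-assoc 25 3 m)
        (trans (cong (25 *_) (*-comm 3 m)) (sym (*-assoc 25 m 3)))))))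

  -- On unnormalised rationals the order is integer cross-multiplication, which here is the
  -- hypothesis itself; no greatest common divisors have to be computed.
  14*x<75*y⇒14/75*x<y : ∀ x y → 14 * x < 75 * y →
    (ℤ.+ 14 ℚ./ 75) ℚ.* (ℤ.+ x ℚ./ 1) ℚ.< ℤ.+ y ℚ./ 1
  14*x<75*y⇒14/75*x<y x y lt = ℚ.toℚᵘ-cancel-< (begin-strict
    ℚ.toℚᵘ ((ℤ.+ 14 ℚ./ 75) ℚ.* (ℤ.+ x ℚ./ 1))
      ≃⟨ ℚ.toℚᵘ-homo-* (ℤ.+ 14 ℚ./ 75) (ℤ.+ x ℚ./ 1) ⟩
    ℚ.toℚᵘ (ℤ.+ 14 ℚ./ 75) ℚᵘ.* ℚ.toℚᵘ (ℤ.+ x ℚ./ 1)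
      -- `mkℚᵘ` takes the predecessor of the denominator: 74 and 0 stand for 75 and 1.
      ≃⟨ ℚᵘ.*-cong (ℚ.toℚᵘ-fromℚᵘ (ℚᵘ.mkℚᵘ (ℤ.+ 14) 74)) (ℚ.toℚᵘ-fromℚᵘ (ℚᵘ.mkℚᵘ (ℤ.+ x) 0)) ⟩
    ℚᵘ.mkℚᵘ (ℤ.+ 14) 74 ℚᵘ.* ℚᵘ.mkℚᵘ (ℤ.+ x) 0
      <⟨ ℚᵘ.*<* (subst₂ ℤ._<_ lhs rhs (ℤ.+<+ lt)) ⟩
    ℚᵘ.mkℚᵘ (ℤ.+ y) 0
      ≃⟨ ℚ.toℚᵘ-fromℚᵘ (ℚᵘ.mkℚᵘ (ℤ.+ y) 0) ⟨
    ℚ.toℚᵘ (ℤ.+ y ℚ./ 1) ∎)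
    where
    open ℚᵘ.≤-Reasoning
    lhs : ℤ.+ (14 * x) ≡ (ℤ.+ 14 ℤ.* ℤ.+ x) ℤ.* ℤ.+ 1
    lhs = trans (ℤ.pos-* 14 x) (sym (ℤ.*-identityʳ _))
    rhs : ℤ.+ (75 * y) ≡ ℤ.+ y ℤ.* ℤ.+ 75
    rhs = trans (ℤ.pos-* 75 y) (ℤ.*-comm (ℤ.+ 75) (ℤ.+ y))

open Hypercube using (large-chosen; chosen; chosen-mutuallyVisible; 14*x<75*y⇒14/75*x<y)
open import Data.Integer using (+_)
open import Data.Nat.Properties using (<-≤-trans; *-monoʳ-≤)
open import Data.Product using (_,_)
open import Data.Nat using (ℕ; NonZero; _^_)
open import Data.Rational using (_/_; _*_; _>_)

theorem1p2 : (n : ℕ) → .{{_ : NonZero n}} → (+ μ (Q n)) / 1 > ((+ 14) / 75) * ((+ (2 ^ n)) / 1)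
theorem1p2 n = let a , large = large-chosen n in
  14*x<75*y⇒14/75*x<y (2 ^ n) (μ (Q n)) (<-≤-trans large (*-monoʳ-≤ 75
    (IsMutualVisibilityNumber.maximal (μ-isMutualVisibilityNumber (Q n)) (chosen n a)
      (chosen-mutuallyVisible n a))))
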